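{- Let $n\geq 12$ be an even integer and let $l=2\lceil\frac{n}{4}\rceil+1$. Among all crg trees on $n$ vertices, the distance between center and centroid is maximized by the tree $T_{rg}^{n,l}$; that is, for every odd $m$ with $3\leq m<n$, $$d_{T_{rg}^{n,m}}\big(C(T_{rg}^{n,m}),C_d(T_{rg}^{n,m})\big)\leq d_{T_{rg}^{n,l}}\big(C(T_{rg}^{n,l}),C_d(T_{rg}^{n,l})\big).$$
   Context: All graphs are finite, simple, connected and undirected. A pendant vertex is a vertex of degree $1$. A binary tree is a tree in which every non-pendant vertex has degree $3$. Center and centroid: the eccentricity of $v\in V(T)$ is $e(v)=\max_{u}d_T(u,v)$; the center $C(T)$ is the set of vertices of minimum eccentricity. A branch at $v$ is a maximal subtree of $T$ containing $v$ as a pendant vertex; the weight of $v$ is the maximum number of edges in a branch at $v$; the centroid $C_d(T)$ is the set of vertices of minimum weight. For $X,Y\subseteq V(T)$, $d_T(X,Y)=\min\{d_T(x,y):x\in X,y\in Y\}$. Rooted binary trees: a rooted binary tree is a rooted tree whose root has degree $2$ and in which every other vertex has degree $1$ or $3$; the single-vertex rooted tree is also allowed. The height (level) of a vertex is its distance to the root. A rooted binary tree is ordered if the vertices of each level $l\ge 1$ are linearly ordered so that two vertices at level $l+1$ with different parents are ordered as their parents are at level $l$. A rooted binary tree is rgood if (i) the heights of any two of its pendant vertices differ by at most $1$, and (ii) it can be ordered so that the parents of the pendant vertices at the highest level form a final segment in the ordering of the vertices at the next-to-highest level. For each odd $l$ there is, up to isomorphism, exactly one rgood binary tree on $l$ vertices,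 denoted $T_{rg}^l$. Crg trees: a binary caterpillar is a binary tree having a path such that every vertex not on the path is adjacent to a vertex of the path. For even $n\ge 4$ and odd $l$ with $3\le l<n$, the crg tree $T_{rg}^{n,l}$ is the tree on $n$ vertices obtained by identifying the root of $T_{rg}^l$ with a vertex of maximum eccentricity of a binary caterpillar on $n-l+1$ vertices. -}

module Defs where

open import Level using (0ℓ)
open import Data.Nat using (ℕ; suc; _+_; _∸_; _/_; _≤_; ∣_-_∣)
open import Data.Fin using (Fin; _<_; _<?_)
open import Data.Fin.Subset using (Subset; _∈_; _⊆_)
open import Data.Fin.Subset.Properties using (_∈?_)
open import Data.List using (List; []; _∷_; length; filter; allFin; cartesianProduct)
open import Data.List.Membership.Propositional using () renaming (_∈_ to _∈ₗ_; _∉_ to _∉ₗ_)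
open import Data.List.Relation.Unary.Unique.Propositional using (Unique)
open import Data.Product using (Σ; ∃; ∃-syntax; _×_; _,_; proj₁; proj₂)
open import Data.Sum using (_⊎_)
open import Function using (_on_; _⇔_)
open import Function.Definitions using (Injective)
open import Relation.Binary using (Rel; Symmetric; Decidable; IsStrictTotalOrder)
open import Relation.Binary.PropositionalEquality using (_≡_; _≢_)
open import Relation.Nullary using (¬_)
open import Relation.Nullary.Decidable using (_×-dec_)
open import Relation.Unary using (Pred)

IsMinimum : Pred ℕ 0ℓ → Pred ℕ 0ℓ
IsMinimum P m = P m × (∀ k → P k → m ≤ k)

IsMaximum : Pred ℕ 0ℓ → Pred ℕ 0ℓ
IsMaximum P m = P m × (∀ k → P k → k ≤ m)

record Graph (n : ℕ) : Set₁ where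
  field
    Adj        : Rel (Fin n) 0ℓ
    adj?       : Decidable Adj
    adj-sym    : Symmetric Adj
    adj-irrefl : ∀ {v} → ¬ Adj v v

open Graph public

private
  variable
    n k l : ℕ

data Walk (G : Graph n) : ℕ → Rel (Fin n) 0ℓ where
  []  : ∀ {v} → Walk G 0 v v
  _∷_ : ∀ {k u v w} → Adj G u v → Walk G k v w → Walk G (suc k) u w

vertices : {G : Graph n} {u v : Fin n} → Walk G k u v → List (Fin n)
vertices {u = u} []      = u ∷ []
vertices {u = u} (_ ∷ w) = u ∷ vertices w

IsPath : {G : Graph n} {u v : Fin n} → Walk G k u v → Set
IsPath w = Unique (vertices w)

Connected : Graph n → Set
Connected G = ∀ u v → ∃[ k ] Walk G k u v

-- A cycle is a path of length at least 2 together with an edge joining its ends.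
Acyclic : Graph n → Set
Acyclic G = ∀ {k u v} (w : Walk G k u v) → IsPath w → 2 ≤ k → ¬ Adj G v u

IsTree : Graph n → Set
IsTree G = Connected G × Acyclic G

degree : Graph n → Fin n → ℕ
degree G v = length (filter (adj? G v) (allFin _))

edgeCount : Graph n → ℕ
edgeCount G =
  length (filter (λ (u , v) → (u <? v) ×-dec adj? G u v)
                 (cartesianProduct (allFin _) (allFin _)))

IsPendant : Graph n → Fin n → Set
IsPendant G v = degree G v ≡ 1

IsBinaryTree : Graph n → Set
IsBinaryTree G = IsTree G × (∀ v → ¬ IsPendant G v → degree G v ≡ 3)

-- Distances, eccentricities and weights are stated as functional relations
-- "the value is k"; on a connected graph (and, for weights, a tree with at
-- least two vertices) each value exists and is unique.

IsDistance : Graph n → Fin n → Fin n → Pred ℕ 0ℓ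
IsDistance G u v = IsMinimum (λ k → Walk G k u v)

IsEccentricity : Graph n → Fin n → Pred ℕ 0ℓ
IsEccentricity G v = IsMaximum (λ d → ∃[ u ] IsDistance G u v d)

Center : Graph n → Pred (Fin n) 0ℓ
Center G v = ∃[ e ] IsEccentricity G v e × (∀ u f → IsEccentricity G u f → e ≤ f)

HasMaximumEccentricity : Graph n → Pred (Fin n) 0ℓ
HasMaximumEccentricity G v = ∃[ e ] IsEccentricity G v e × (∀ u f → IsEccentricity G u f → f ≤ e)

-- The subgraph of G induced by S, with the vertices outside S kept as isolated
-- vertices (so degrees in S and the number of edges are those of the subgraph).
induced : Graph n → Subset n → Graph n
induced G S = record
  { Adj        = λ u v → u ∈ S × v ∈ S × Adj G u v
  ; adj?       = λ u v → (u ∈? S) ×-dec ((v ∈? S) ×-dec adj? G u v)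
  ; adj-sym    = λ (u∈S , v∈S , uv) → v∈S , u∈S , adj-sym G uv
  ; adj-irrefl = λ (_ , _ , vv) → adj-irrefl G vv
  }

-- For G a tree: a subtree is a connected subgraph, and it is induced by its
-- vertex set because G has no cycles.
IsSubtree : Graph n → Pred (Subset n) 0ℓ
IsSubtree G S = ∃ (_∈ S) × (∀ u v → u ∈ S → v ∈ S → ∃[ k ] Walk (induced G S) k u v)

IsSubtreeWithPendant : Graph n → Fin n → Pred (Subset n) 0ℓ
IsSubtreeWithPendant G v S = IsSubtree G S × v ∈ S × IsPendant (induced G S) v

IsBranch : Graph n → Fin n → Pred (Subset n) 0ℓ
IsBranch G v B = IsSubtreeWithPendant G v B
               × (∀ S → IsSubtreeWithPendant G v S → B ⊆ S → S ⊆ B)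

IsWeight : Graph n → Fin n → Pred ℕ 0ℓ
IsWeight G v = IsMaximum (λ w → ∃[ B ] IsBranch G v B × edgeCount (induced G B) ≡ w)

Centroid : Graph n → Pred (Fin n) 0ℓ
Centroid G v = ∃[ w ] IsWeight G v w × (∀ u x → IsWeight G u x → w ≤ x)

IsSetDistance : Graph n → Pred (Fin n) 0ℓ → Pred (Fin n) 0ℓ → Pred ℕ 0ℓ
IsSetDistance G X Y = IsMinimum (λ d → ∃[ x ] ∃[ y ] X x × Y y × IsDistance G x y d)

IsRootedBinaryTree : (G : Graph n) → Fin n → Set
IsRootedBinaryTree {n} G r =
  IsTree G × (n ≡ 1 ⊎ (degree G r ≡ 2 × (∀ v → v ≢ r → degree G v ≡ 1 ⊎ degree G v ≡ 3)))

module Rooted (G : Graph n) (r : Fin n) where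

  Level : ℕ → Pred (Fin n) 0ℓ
  Level k v = IsDistance G r v k

  Parent : Rel (Fin n) 0ℓ
  Parent p v = Adj G p v × ∃[ k ] Level k p × Level (suc k) v

  -- One relation carries the orders of all levels; vertices on different
  -- levels are not compared.
  record IsOrdering (_⊏_ : Rel (Fin n) 0ℓ) : Set where
    field
      linear     : ∀ k → 1 ≤ k →
                   IsStrictTotalOrder {A = ∃ (Level k)} (_≡_ on proj₁) (_⊏_ on proj₁)
      compatible : ∀ k {u v p q} → 1 ≤ k → Level (suc k) u → Level (suc k) v →
                   Parent p u → Parent q v → p ≢ q → p ⊏ q → u ⊏ v

  IsHeight : Pred ℕ 0ℓ
  IsHeight = IsMaximum (λ k → ∃ (Level k))

  ParentOfPendantAt : ℕ → Pred (Fin n) 0ℓ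
  ParentOfPendantAt h p = ∃[ v ] IsPendant G v × Level h v × Parent p v

  IsRgood : Set₁
  IsRgood =
      (∀ {u v h k} → IsPendant G u → IsPendant G v → Level h u → Level k v → ∣ h - k ∣ ≤ 1)
    × (Σ (Rel (Fin n) 0ℓ) λ _⊏_ → IsOrdering _⊏_
        × (∀ {k u v} → IsHeight (suc k) → Level k u → Level k v →
             ParentOfPendantAt (suc k) u → u ⊏ v → ParentOfPendantAt (suc k) v))

-- (R , r) is the rooted tree T_rg^l.
IsRgoodBinaryTree : (R : Graph l) → Fin l → Set₁
IsRgoodBinaryTree R r = IsRootedBinaryTree R r × Rooted.IsRgood R r

IsBinaryCaterpillar : Graph n → Set
IsBinaryCaterpillar G =
  IsBinaryTree G ×
  ∃[ k ] ∃[ u ] ∃[ v ] Σ (Walk G k u v) λ w → IsPath w ×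
    (∀ x → x ∉ₗ vertices w → ∃[ y ] (y ∈ₗ vertices w × Adj G x y))

-- T is, up to isomorphism, the disjoint union of G and H with x and y identified.
record IsIdentification (G : Graph k) (x : Fin k) (H : Graph l) (y : Fin l)
                        (T : Graph n) : Set where
  field
    ι₁           : Fin k → Fin n
    ι₂           : Fin l → Fin n
    ι₁-injective : Injective _≡_ _≡_ ι₁
    ι₂-injective : Injective _≡_ _≡_ ι₂
    covering     : ∀ v → (∃[ a ] ι₁ a ≡ v) ⊎ (∃[ b ] ι₂ b ≡ v)
    glued        : ∀ {a b} → ι₁ a ≡ ι₂ b ⇔ (a ≡ x × b ≡ y)
    adjacency    : ∀ {u v} → Adj T u v ⇔
                     ( (∃[ a ] ∃[ b ] ι₁ a ≡ u × ι₁ b ≡ v × Adj G a b)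
                     ⊎ (∃[ a ] ∃[ b ] ι₂ a ≡ u × ι₂ b ≡ v × Adj H a b))

-- T is (isomorphic to) the crg tree T_rg^{n,l}.
IsCrg : (n l : ℕ) → Graph n → Set₁
IsCrg n l T =
  Σ (Graph (n ∸ l + 1)) λ C → Σ (Fin (n ∸ l + 1)) λ c →
  Σ (Graph l) λ R → Σ (Fin l) λ r →
    IsBinaryCaterpillar C × HasMaximumEccentricity C c
  × IsRgoodBinaryTree R r
  × IsIdentification C c R r T

IsCenterCentroidDistance : Graph n → Pred ℕ 0ℓ
IsCenterCentroidDistance T = IsSetDistance T (Center T) (Centroid T)

⌈_/4⌉ : ℕ → ℕ
⌈ n /4⌉ = (n + 3) / 4

{-# OPTIONS --safe #-}

-- Let the rgood tree have 2q + 1 vertices and height h, and let the caterpillar have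
-- p vertices of degree 3, so that p + q + 1 = n / 2; number the spine of the caterpillar
-- from the common vertex c, numbered 0. If h ≤ p + 1, a longest path runs through c
-- along the whole spine, so the center is at position (p + 1 - h) / 2 up to rounding;
-- otherwise the center is c or a child of c in the rgood tree. A vertex is a centroid as
-- soon as all its branches have at most n / 2 edges; this holds at position (p + 1 - q) / 2
-- of the spine if q ≤ p, and at c or at the root of its larger subtree if p < q. As
-- 2^(h-1) ≤ q < 2^h, the distance is about (q - h) / 2 in the first case, which grows with
-- q, and about (p + 1 - h) / 2 in the second, which decreases with q; the optimum is at
-- q = ⌈n / 4⌉, where p and q are nearly equal.
module Submission where

open import Defs
open import Data.Nat using (ℕ; _+_; _*_; _≤_; _<_)
open import Data.Nat.Divisibility using (_∣_)
open import Relation.Nullary using (¬_)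

open import Level using (0ℓ)
open import Data.Fin using (Fin; _≟_) renaming (_<_ to _<ᶠ_; _<?_ to _<ᶠ?_)
import Data.Fin.Properties as Finₚ
open import Data.Fin.Subset using (Subset; _∈_; _⊆_)
open import Data.Fin.Subset.Properties using (⊆-antisym)
open import Data.List using (List; []; _∷_; length; filter; allFin; cartesianProduct; map)
import Data.List as List
open import Data.List.Extrema.Nat using (argmax; argmax-all; f[xs]≤f[argmax])
open import Data.List.Membership.Propositional using () renaming (_∈_ to _∈ₗ_; _∉_ to _∉ₗ_)
open import Data.List.Membership.Propositional.Properties
  using (∈-filter⁺; ∈-filter⁻; ∈-allFin; ∈-map⁻; ∈-cartesianProduct⁺)
open import Data.List.Properties using (length-map; length-tabulate)
open import Data.List.Relation.Unary.All using ([]; _∷_)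
import Data.List.Relation.Unary.All as All
import Data.List.Relation.Unary.All.Properties as Allₚ
open import Data.List.Relation.Unary.AllPairs using ([]; _∷_)
open import Data.List.Relation.Unary.Any using (here; there; any?; _─_)
open import Data.List.Relation.Unary.Unique.Propositional using (Unique)
import Data.List.Relation.Unary.Unique.Propositional.Properties as Uniqueₚ
open import Data.Nat
  using (zero; suc; _∸_; _^_; _%_; _⊔_; ∣_-_∣; z≤n; s≤s; _<?_; _≤?_)
  renaming (_≟_ to _≟ⁿ_)
open import Data.Nat.Divisibility using (divides)
open import Data.Nat.DivMod using (m≡m%n+[m/n]*n; m%n<n)
open import Data.Nat.Properties hiding (_≟_; _<?_; _≤?_)
open import Data.Nat.Tactic.RingSolver using (solve)
open import Data.Product using (∃; ∃-syntax; Σ; _×_; _,_; proj₁; proj₂; swap)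
open import Data.Product.Properties using (,-injectiveˡ; ,-injectiveʳ)
open import Data.Sum using (_⊎_; inj₁; inj₂; [_,_]′)
import Data.Sum as Sum
open import Data.Empty using (⊥; ⊥-elim)
open import Data.Unit using (⊤; tt)
open import Data.Vec using (tabulate)
open import Data.Vec.Properties using (lookup⇒[]=; []=⇒lookup; lookup∘tabulate)
open import Function using (_∘_; id; const; mk⇔; Equivalence)
open import Relation.Binary using (tri<; tri≈; tri>)
open import Relation.Binary.PropositionalEquality
open import Relation.Nullary using (Dec; yes; no; contradiction; does)
open import Relation.Nullary.Decidable using (_×-dec_; _⊎-dec_; ¬?; map′; dec-true)
open import Relation.Unary using (Pred; Decidable)

-- Counting in finite sets

-- The two sides of the comparison need different strength. Bounding `d` from above takes one center
-- and one centroid vertex per configuration; `d*` is bounded from below for the optimal tree alone,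
-- but over all pairs, and there one light vertex forces every centroid to be light. Floors are
-- avoided: upper bounds on `d` are brought to the form `2d + h* ≤ p* + 1`, with starred values for
-- the optimal tree, and meet `p* ≤ 2d* + h*`, which leaves `2d ≤ 2d* + 1`. The delicate case is a
-- centroid at the root of the larger subtree of the rgood tree, where `d` can be larger by one. The
-- order `B` of the smaller subtree pays for this: heaviness of the larger one gives
-- `p + 2 + B ≤ q`, hence `2p + B ≤ 2p*`, while `B` is exponential in the height. Acyclicity is used
-- in the form that every edge is a bridge. Then a vertex has only one neighbour closer to a given
-- target, so an edge splits the vertices into two sides that can be counted, and the property
-- passes to glued trees by a retraction.

least : ∀ {P : Pred ℕ 0ℓ} → Decidable P → ∀ k → P k → ∃ (IsMinimum P)
least P? zero p = 0 , p , λ _ _ → z≤n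
least {P} P? (suc k) p with P? 0
... | yes p₀ = 0 , p₀ , λ _ _ → z≤n
... | no ¬p₀ with least (λ j → P? (suc j)) k p
...   | m , pm , minimal = suc m , pm , λ
          { zero    p₀ → contradiction p₀ ¬p₀
          ; (suc j) pⱼ → s≤s (minimal j pⱼ) }

maximiser : ∀ {n} {P : Pred (Fin n) 0ℓ} → Decidable P → (f : Fin n → ℕ) → ∃ P →
            ∃[ x ] P x × (∀ y → P y → f y ≤ f x)
maximiser P? f (x₀ , p₀) =
    argmax f x₀ xs
  , argmax-all f p₀ (All.tabulate (λ x∈ → proj₂ (∈-filter⁻ P? {xs = allFin _} x∈)))
  , λ y py → All.lookup (f[xs]≤f[argmax] x₀ xs) (∈-filter⁺ P? (∈-allFin y) py)
  where xs = filter P? (allFin _)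

module _ {A : Set} where

  private
    ∈-─ : ∀ {x y : A} {ys} (x∈ : x ∈ₗ ys) → y ∈ₗ ys → y ≢ x → y ∈ₗ (ys ─ x∈)
    ∈-─ (here refl) (here refl) y≢x = contradiction refl y≢x
    ∈-─ (here refl) (there y∈)  _   = y∈
    ∈-─ (there x∈)  (here refl) _   = here refl
    ∈-─ (there x∈)  (there y∈)  y≢x = there (∈-─ x∈ y∈ y≢x)

    length-─ : ∀ {x : A} {ys} (x∈ : x ∈ₗ ys) → length ys ≡ suc (length (ys ─ x∈))
    length-─ (here _)   = refl
    length-─ (there x∈) = cong suc (length-─ x∈)

  unique-⊆⇒length-≤ : ∀ {xs ys : List A} → Unique xs →
                      (∀ {x} → x ∈ₗ xs → x ∈ₗ ys) → length xs ≤ length ys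
  unique-⊆⇒length-≤ []         sub = z≤n
  unique-⊆⇒length-≤ (x∉ ∷ uxs) sub rewrite length-─ (sub (here refl)) =
    s≤s (unique-⊆⇒length-≤ uxs λ y∈ → ∈-─ (sub (here refl)) (sub (there y∈))
      λ y≡x → All.lookup x∉ y∈ (sym y≡x))

private
  injective-map-unique : ∀ {A B : Set} (f : A → B) {xs : List A} → Unique xs →
    (∀ {x y} → x ∈ₗ xs → y ∈ₗ xs → f x ≡ f y → x ≡ y) → Unique (map f xs)
  injective-map-unique f []         inj = []
  injective-map-unique f (x∉ ∷ uxs) inj =
    Allₚ.map⁺ (All.tabulate λ y∈ fx≡fy →
      All.lookup x∉ y∈ (inj (here refl) (there y∈) fx≡fy))
    ∷ injective-map-unique f uxs λ x∈ y∈ → inj (there x∈) (there y∈)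

length-injection : ∀ {A B : Set} (f : A → B) {xs : List A} {ys : List B} → Unique xs →
  (∀ {x} → x ∈ₗ xs → f x ∈ₗ ys) →
  (∀ {x y} → x ∈ₗ xs → y ∈ₗ xs → f x ≡ f y → x ≡ y) → length xs ≤ length ys
length-injection f {xs} {ys} uxs maps inj = subst (_≤ length ys) (length-map f xs)
  (unique-⊆⇒length-≤ (injective-map-unique f uxs inj) λ y∈ →
    let (x , x∈ , y≡fx) = ∈-map⁻ f y∈ in subst (_∈ₗ ys) (sym y≡fx) (maps x∈))

count : ∀ {n} {P : Pred (Fin n) 0ℓ} → Decidable P → ℕ
count P? = length (filter P? (allFin _))

module _ {n : ℕ} {P : Pred (Fin n) 0ℓ} (P? : Decidable P) where

  ∈-count⁺ : ∀ {x} → P x → x ∈ₗ filter P? (allFin n)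
  ∈-count⁺ = ∈-filter⁺ P? (∈-allFin _)

  ∈-count⁻ : ∀ {x} → x ∈ₗ filter P? (allFin n) → P x
  ∈-count⁻ x∈ = proj₂ (∈-filter⁻ P? {xs = allFin n} x∈)

  unique-count : Unique (filter P? (allFin n))
  unique-count = Uniqueₚ.filter⁺ P? (Uniqueₚ.allFin⁺ n)

count-singleton : ∀ {n} {P : Pred (Fin n) 0ℓ} (P? : Decidable P) v →
                  P v → (∀ x → P x → x ≡ v) → count P? ≡ 1
count-singleton P? v pv only = ≤-antisym
  (unique-⊆⇒length-≤ {ys = v ∷ []} (unique-count P?) λ x∈ → here (only _ (∈-count⁻ P? x∈)))
  (unique-⊆⇒length-≤ {xs = v ∷ []} ([] ∷ []) λ { (here refl) → ∈-count⁺ P? pv })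

module _ {n : ℕ} {P Q R : Pred (Fin n) 0ℓ}
         (P? : Decidable P) (Q? : Decidable Q) (R? : Decidable R) where

  count-⊎ : (∀ x → R x → P x ⊎ Q x) → (∀ x → P x → R x) → (∀ x → Q x → R x) →
            (∀ x → P x → ¬ Q x) → count R? ≡ count P? + count Q?
  count-⊎ split inP inQ disjoint = go (allFin n)
    where
    go : ∀ xs → length (filter R? xs) ≡ length (filter P? xs) + length (filter Q? xs)
    go [] = refl
    go (x ∷ xs) with R? x | P? x | Q? x
    ... | _      | yes p | yes q = contradiction q (disjoint x p)
    ... | yes _  | yes _ | no _  = cong suc (go xs)
    ... | yes _  | no _  | yes _ = trans (cong suc (go xs)) (sym (+-suc _ _))
    ... | yes r  | no ¬p | no ¬q with split x r
    ...   | inj₁ p = contradiction p ¬p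
    ...   | inj₂ q = contradiction q ¬q
    go (x ∷ xs) | no ¬r | yes p | no _  = contradiction (inP x p) ¬r
    go (x ∷ xs) | no ¬r | no _  | yes q = contradiction (inQ x q) ¬r
    go (x ∷ xs) | no _  | no _  | no _  = go xs

count-all : ∀ n → count {n} {λ _ → ⊤} (λ _ → yes tt) ≡ n
count-all n = trans (go (allFin n)) (length-tabulate id)
  where
  go : (xs : List (Fin n)) → length (filter {P = λ _ → ⊤} (λ _ → yes tt) xs) ≡ length xs
  go []       = refl
  go (x ∷ xs) = cong suc (go xs)

count-cover : ∀ {n} {P Q : Pred (Fin n) 0ℓ} (P? : Decidable P) (Q? : Decidable Q) →
              (∀ x → P x ⊎ Q x) → n ≤ count P? + count Q?
count-cover {n} P? Q? cover =
  subst (_≤ count P? + count Q?) (length-tabulate {n = n} id) (go (allFin n))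
  where
  go : ∀ xs → length xs ≤ length (filter P? xs) + length (filter Q? xs)
  go [] = z≤n
  go (x ∷ xs) with P? x | Q? x
  ... | yes _ | yes _ = s≤s (≤-trans (go xs) (+-monoʳ-≤ (length (filter P? xs)) (n≤1+n _)))
  ... | yes _ | no _  = s≤s (go xs)
  ... | no _  | yes _ rewrite +-suc (length (filter P? xs)) (length (filter Q? xs)) = s≤s (go xs)
  ... | no ¬p | no ¬q with cover x
  ...   | inj₁ p = contradiction p ¬p
  ...   | inj₂ q = contradiction q ¬q

-- Linear arithmetic

-- The linear consequence x ≤ y of X ≤ Y: after adding the slack k the two sides
-- differ by a ring identity.
linear : ∀ {x y X Y} k → X ≤ Y → x + Y + k ≡ y + X → x ≤ y
linear {x} {y} {X} {Y} k X≤Y eq = +-cancelʳ-≤ Y x y (begin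
  x + Y       ≤⟨ m≤m+n (x + Y) k ⟩
  x + Y + k   ≡⟨ eq ⟩
  y + X       ≤⟨ +-monoʳ-≤ y X≤Y ⟩
  y + Y       ∎)
  where open ≤-Reasoning

-- Absorbs the unit lost to rounding: an excess of one between two even numbers is no excess.
a+a≤1+b+b⇒a≤b : ∀ {a b} → a + a ≤ suc (b + b) → a ≤ b
a+a≤1+b+b⇒a≤b {a} {b} h with ≤-<-connex a b
... | inj₁ a≤b = a≤b
... | inj₂ b<a = contradiction (≤-trans (+-mono-≤ b<a b<a) h)
                   (<⇒≱ (s≤s (≤-reflexive (sym (+-suc b b)))))

comb-light : ∀ k n → (suc k + suc k) + (suc k + suc k) ≤ n + 2 → suc (k + k) + suc (k + k) ≤ n
comb-light k n le = linear 0 le (solve (k List.∷ n List.∷ List.[]))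

-- With `p = k + i`, the left side is `n`, and `suc (k + k)` is the order of the part of the
-- caterpillar from position `i + 1` on.
spine-heavy : ∀ k i q → suc i + suc i + q ≤ suc (suc (k + i)) →
              suc (k + i + q) + suc (k + i + q) ≤ suc (k + k) + suc (k + k)
spine-heavy k i q le = linear 0 (+-mono-≤ le le) (solve (k List.∷ i List.∷ q List.∷ List.[]))

spine-child-light : ∀ k i q → k + i ≤ suc i + suc i + q →
              (k + k) + (k + k) ≤ suc (k + i + q) + suc (k + i + q) + 2
spine-child-light k i q le = linear 0 (+-mono-≤ le le) (solve (k List.∷ i List.∷ q List.∷ List.[]))

spine-index : ∀ p i q → suc i + suc i + q ≤ suc (suc p) → i ≤ p
spine-index p i q le = linear (i + q) le (solve (p List.∷ i List.∷ q List.∷ List.[]))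

tail-light : ∀ p q → p ≤ q → suc (p + p) + suc (p + p) ≤ suc (p + q) + suc (p + q)
tail-light p q le = linear 0 (+-mono-≤ le le) (solve (p List.∷ q List.∷ List.[]))

center-short₁ : ∀ p h i → i + i + h ≤ suc (suc p) → (h + i) + (h + i) ≤ suc (suc p + h)
center-short₁ p h i le = linear 0 le (solve (p List.∷ h List.∷ i List.∷ List.[]))

center-short₂ : ∀ p h i → h + i + i ≤ p → suc (h + i) + suc (h + i) ≤ suc (suc p + h)
center-short₂ p h i le = linear 0 le (solve (p List.∷ h List.∷ i List.∷ List.[]))

center-far : ∀ p h i → p ≤ i + i + h → suc p ≤ suc (h + i) + i
center-far p h i le = linear 0 le (solve (p List.∷ h List.∷ i List.∷ List.[]))

center-index : ∀ p k i → i + i + suc k ≤ suc (suc p) → i ≤ suc p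
center-index p k i le = linear (i + k) le (solve (p List.∷ k List.∷ i List.∷ List.[]))

sibling-light : ∀ p q A B → A + B ≡ q + q → suc (p + q) < A → B ≤ suc (p + q)
sibling-light p q A B eq lt = linear (3 + (p + p)) (+-mono-≤ lt (≤-reflexive eq))
  (solve (p List.∷ q List.∷ A List.∷ B List.∷ List.[]))

sibling-small : ∀ p q A B → A + B ≡ q + q → suc (p + q) < A → suc (suc p) + B ≤ q
sibling-small p q A B eq lt = linear 0 (+-mono-≤ lt (≤-reflexive eq))
  (solve (p List.∷ q List.∷ A List.∷ B List.∷ List.[]))

child-light : ∀ p q A B → A + B ≡ q + q → 1 ≤ B → q ≤ suc (suc p) → A ≤ suc (p + q)
child-light p q A B eq 1≤B q≤ = linear 0 (+-mono-≤ (+-mono-≤ (≤-reflexive eq) 1≤B) q≤)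
  (solve (p List.∷ q List.∷ A List.∷ B List.∷ List.[]))

double-+ : ∀ d i b m → d ≤ i → i + i + b ≤ m → d + d + b ≤ m
double-+ d i b m d≤i = ≤-trans (+-monoˡ-≤ b (+-mono-≤ d≤i d≤i))

double-suc : ∀ d i b m → d ≤ suc i → i + i + b ≤ m → d + d + b ≤ suc (suc m)
double-suc d i b m d≤ le = linear 0 (+-mono-≤ (+-mono-≤ d≤ d≤) le)
  (solve (d List.∷ i List.∷ b List.∷ m List.∷ List.[]))

-- Meant for a vertex of the caterpillar: `X` is the size of its branch towards `c`, which together
-- with the caterpillar's branch at `c` covers the tree. If `X` is at most `n / 2`, then `p < q` is
-- impossible.
off-tail : ∀ p q X → suc (p + q) + suc (p + q) ≤ X + suc (p + p) → X + X ≤ suc (p + q) + suc (p + q) →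
           q + q ≤ suc (p + p)
off-tail p q X le₁ le₂ = linear 1 (+-mono-≤ (+-mono-≤ le₁ le₁) le₂)
  (solve (p List.∷ q List.∷ X List.∷ List.[]))

-- Walks, distances and sides of an edge

private
  variable
    n n′ : ℕ

infixr 5 _++ʷ_

_++ʷ_ : ∀ {k l} {G : Graph n} {u v w} → Walk G k u v → Walk G l v w → Walk G (k + l) u w
[]       ++ʷ w′ = w′
(e ∷ w) ++ʷ w′ = e ∷ (w ++ʷ w′)

reverseʷ : ∀ {k} {G : Graph n} {u v} → Walk G k u v → Walk G k v u
reverseʷ []                    = []
reverseʷ {G = G} {u} {v} (_∷_ {k} e w) =
  subst (λ j → Walk G j v u) (+-comm k 1) (reverseʷ w ++ʷ (adj-sym G e ∷ []))

mapʷ : ∀ {k} {G : Graph n} {H : Graph n′} {f : Fin n → Fin n′} →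
       (∀ {u v} → Adj G u v → Adj H (f u) (f v)) →
       ∀ {u v} → Walk G k u v → Walk H k (f u) (f v)
mapʷ hom []      = []
mapʷ hom (e ∷ w) = hom e ∷ mapʷ hom w

walk? : ∀ (G : Graph n) u v k → Dec (Walk G k u v)
walk? G u v zero    = map′ (λ { refl → [] }) (λ { [] → refl }) (u ≟ v)
walk? G u v (suc k) = map′ (λ { (_ , e , w) → e ∷ w }) (λ { (e ∷ w) → _ , e , w })
  (Finₚ.any? λ x → adj? G u x ×-dec walk? G x v k)

start∈ : ∀ {k} {G : Graph n} {u v} (w : Walk G k u v) → u ∈ₗ vertices w
start∈ []      = here refl
start∈ (_ ∷ _) = here refl

pathFrom : ∀ {k} {G : Graph n} {u v x} (w : Walk G k u v) → IsPath w → x ∈ₗ vertices w →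
           ∃[ j ] Σ (Walk G j x v) IsPath
pathFrom []      p       (here refl) = 0 , [] , p
pathFrom (e ∷ w) p       (here refl) = _ , e ∷ w , p
pathFrom (e ∷ w) (_ ∷ p) (there x∈)  = pathFrom w p x∈

toPath : ∀ {k} {G : Graph n} {u v} → Walk G k u v → ∃[ j ] Σ (Walk G j u v) IsPath
toPath [] = 0 , [] , All.[] ∷ []
toPath {u = u} (e ∷ w) with toPath w
... | j , w′ , p with any? (u ≟_) (vertices w′)
...   | yes u∈ = pathFrom w′ p u∈
...   | no  u∉ = suc j , e ∷ w′ , Allₚ.¬Any⇒All¬ _ u∉ ∷ p

-- Bridges and the two sides of an edge

deleteEdge : Graph n → Fin n → Fin n → Graph n
deleteEdge G a b = record
  { Adj        = λ u v → Adj G u v × ¬ (u ≡ a × v ≡ b) × ¬ (u ≡ b × v ≡ a)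
  ; adj?       = λ u v → adj? G u v ×-dec (¬? ((u ≟ a) ×-dec (v ≟ b)) ×-dec ¬? ((u ≟ b) ×-dec (v ≟ a)))
  ; adj-sym    = λ (e , ¬ab , ¬ba) →
      adj-sym G e , (λ (p , q) → ¬ba (q , p)) , (λ (p , q) → ¬ab (q , p))
  ; adj-irrefl = λ (e , _) → adj-irrefl G e
  }

-- The working form of acyclicity. It is contradicted by any walk, not only by a path, so walks may
-- be concatenated and retracted freely.
AllBridges : Graph n → Set
AllBridges G = ∀ {a b} → Adj G a b → ∀ {k} → ¬ Walk (deleteEdge G a b) k a b

acyclic⇒allBridges : ∀ (G : Graph n) → Acyclic G → AllBridges G
acyclic⇒allBridges G acyclic {a} {b} ab w with toPath w
... | zero        , []           , _ = adj-irrefl G ab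
... | suc zero    , (e ∷ [])     , _ = proj₁ (proj₂ e) (refl , refl)
... | suc (suc _) , w′@(_ ∷ _ ∷ _) , p =
  acyclic (forget w′) (subst Unique (sym (vertices-forget w′)) p) (s≤s (s≤s z≤n)) (adj-sym G ab)
  where
  forget : ∀ {k u v} → Walk (deleteEdge G a b) k u v → Walk G k u v
  forget = mapʷ proj₁
  vertices-forget : ∀ {k u v} (w : Walk (deleteEdge G a b) k u v) →
                    vertices (forget w) ≡ vertices w
  vertices-forget []      = refl
  vertices-forget (_ ∷ w) = cong (_ ∷_) (vertices-forget w)

module Metric (G : Graph n) (conn : Connected G) where

  private
    distance : ∀ u v → ∃ (IsDistance G u v)
    distance u v = least (walk? G u v) (proj₁ (conn u v)) (proj₂ (conn u v))

  abstract
    dist : Fin n → Fin n → ℕ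
    dist u v = proj₁ (distance u v)

    isDistance : ∀ u v → IsDistance G u v (dist u v)
    isDistance u v = proj₂ (distance u v)

  geodesic : ∀ u v → Walk G (dist u v) u v
  geodesic u v = proj₁ (isDistance u v)

  dist-≤ : ∀ {u v k} → Walk G k u v → dist u v ≤ k
  dist-≤ w = proj₂ (isDistance _ _) _ w

  dist-unique : ∀ {u v d} → IsDistance G u v d → d ≡ dist u v
  dist-unique (w , minimal) = ≤-antisym (minimal _ (geodesic _ _)) (dist-≤ w)

  dist-refl : ∀ v → dist v v ≡ 0
  dist-refl v = n≤0⇒n≡0 (dist-≤ [])

  dist≡0⇒≡ : ∀ {u v} → dist u v ≡ 0 → u ≡ v
  dist≡0⇒≡ {u} {v} d≡0 = go (subst (λ k → Walk G k u v) d≡0 (geodesic u v))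
    where
    go : Walk G 0 u v → u ≡ v
    go [] = refl

  private
    dist-sym-≤ : ∀ u v → dist u v ≤ dist v u
    dist-sym-≤ u v = dist-≤ (reverseʷ (geodesic v u))

  dist-sym : ∀ u v → dist u v ≡ dist v u
  dist-sym u v = ≤-antisym (dist-sym-≤ u v) (dist-sym-≤ v u)

  triangle : ∀ u v w → dist u w ≤ dist u v + dist v w
  triangle u v w = dist-≤ (geodesic u v ++ʷ geodesic v w)

  dist-adj : ∀ {u v} r → Adj G u v → dist u r ≤ suc (dist v r)
  dist-adj r e = dist-≤ (e ∷ geodesic _ r)

  adj⇒≢ : ∀ {u v} → Adj G u v → u ≢ v
  adj⇒≢ e refl = adj-irrefl G e

  towards : ∀ u r → u ≢ r → ∃[ v ] Adj G u v × suc (dist v r) ≡ dist u r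
  towards u r u≢r = go (geodesic u r) refl
    where
    go : ∀ {k} → Walk G k u r → k ≡ dist u r → ∃[ v ] Adj G u v × suc (dist v r) ≡ dist u r
    go []      _  = contradiction refl u≢r
    go (e ∷ w) eq = _ , e , ≤-antisym (subst (_ ≤_) eq (s≤s (dist-≤ w))) (dist-adj r e)

  -- Finds a geodesic to `r` inside a subgraph: only the edges leading closer to `r` from within
  -- distance `b` have to survive the deletion.
  descend : ∀ (H : Graph n) r b →
    (∀ {x y} → Adj G x y → suc (dist y r) ≡ dist x r → dist x r ≤ b → Adj H x y) →
    ∀ k x → dist x r ≡ k → k ≤ b → Walk H k x r
  descend H r b keep zero    x d≡ _ with refl ← dist≡0⇒≡ d≡ = []
  descend H r b keep (suc k) x d≡ k<b
    with towards x r (λ { refl → contradiction (trans (sym (dist-refl r)) d≡) λ () })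
  ... | y , e , step = keep e step (subst (_≤ b) (sym d≡) k<b)
      ∷ descend H r b keep k y (suc-injective (trans step d≡)) (<⇒≤ k<b)

module Tree (G : Graph n) (conn : Connected G) (bridges : AllBridges G) where

  open Metric G conn public

  -- Adjacent vertices at equal distance from r would be joined through r by two
  -- geodesics, neither of which uses their edge.
  adj-dist-≢ : ∀ {a b} r → Adj G a b → dist a r ≢ dist b r
  adj-dist-≢ {a} {b} r ab same = bridges ab
    (descend H r _ keep _ a refl ≤-refl ++ʷ reverseʷ (descend H r _ keep _ b refl (≤-reflexive (sym same))))
    where
    H = deleteEdge G a b
    keep : ∀ {x y} → Adj G x y → suc (dist y r) ≡ dist x r → dist x r ≤ dist a r → Adj H x y
    keep e step _ = e
      , (λ { (refl , refl) → 1+n≢n (trans step same) })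
      , (λ { (refl , refl) → 1+n≢n (trans step (sym same)) })

  -- For adjacent `v` and `w` this is the component of `w` after deletion of the edge `vw`; the
  -- description by distances makes it decidable at once.
  Side : Fin n → Fin n → Pred (Fin n) 0ℓ
  Side v w u = dist w u < dist v u

  side? : ∀ v w u → Dec (Side v w u)
  side? v w u = dist w u <? dist v u

  size : Fin n → Fin n → ℕ
  size v w = count (side? v w)

  -- Otherwise stepping to `b`, descending to `r` and climbing back to `a` would bypass the edge
  -- `ua`.
  side-unique : ∀ {u a b r} → Adj G u a → Adj G u b → Side u a r → Side u b r → a ≡ b
  side-unique {u} {a} {b} {r} ua ub a<u b<u with a ≟ b
  ... | yes a≡b = a≡b
  ... | no  a≢b = contradiction
    (((ub , (λ (_ , b≡a) → a≢b (sym b≡a)) , (λ (u≡a , _) → adj⇒≢ ua u≡a))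
      ∷ descend H r _ keep _ b refl (≤-pred (subst (_ ≤_) u≡ b<u)))
     ++ʷ reverseʷ (descend H r _ keep _ a refl ≤-refl))
    (bridges ua)
    where
    H = deleteEdge G u a
    u≡ : dist u r ≡ suc (dist a r)
    u≡ = ≤-antisym (dist-adj r ua) a<u
    keep : ∀ {x y} → Adj G x y → suc (dist y r) ≡ dist x r → dist x r ≤ dist a r → Adj H x y
    keep e step x≤a = e
      , (λ { (refl , _) → <⇒≱ a<u x≤a })
      , (λ { (refl , refl) → <⇒≱ a<u (≤-trans (n≤1+n _) (≤-reflexive step)) })

  side-step : ∀ {v w u} → Adj G v w → Side v w u → dist v u ≡ suc (dist w u)
  side-step {u = u} e s = ≤-antisym (dist-adj u e) s

  side-⊎ : ∀ {v w} u → Adj G v w → Side v w u ⊎ Side w v u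
  side-⊎ {v} {w} u e with <-cmp (dist w u) (dist v u)
  ... | tri< lt _ _ = inj₁ lt
  ... | tri≈ _ eq _ = contradiction (sym eq) (adj-dist-≢ u e)
  ... | tri> _ _ gt = inj₂ gt

  side-¬ : ∀ {v w u} → Adj G v w → ¬ Side v w u → Side w v u
  side-¬ {u = u} e ¬s with side-⊎ u e
  ... | inj₁ s = contradiction s ¬s
  ... | inj₂ s = s

  side-self : ∀ {v w} → Adj G v w → Side v w w
  side-self {v} {w} e with side-⊎ w e
  ... | inj₁ s = s
  ... | inj₂ s = contradiction (subst (dist v w <_) (dist-refl w) s) n≮0

  side⇒≢ : ∀ {v w u} → Side v w u → u ≢ v
  side⇒≢ {v} {w} s refl = contradiction (subst (dist w v <_) (dist-refl v) s) n≮0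

  side-extend : ∀ {p v a u} → Adj G p v → Adj G v a → a ≢ p → Side v a u → Side p v u
  side-extend {u = u} pv va a≢p s with side-⊎ u pv
  ... | inj₁ s′ = s′
  ... | inj₂ s′ = contradiction (side-unique va (adj-sym G pv) s s′) a≢p

  side-split : ∀ {p v u} → Side p v u → u ≢ v → ∃[ a ] Adj G v a × a ≢ p × Side v a u
  side-split {p} {v} {u} s u≢v with towards v u (u≢v ∘ sym)
  ... | a , va , step = a , va , (λ { refl → <-asym s (≤-reflexive step) }) , ≤-reflexive step

  -- If `u` were not `v`, then `u₁` and the neighbour of `u` towards `v` would both be closer to `p`
  -- than `u`, hence equal; this would put `u` at least as close to `p` as to `v`.
  side-cross : ∀ {p v u u₁} → Adj G p v → Adj G u u₁ → Side p v u → Side v p u₁ → u ≡ v × u₁ ≡ p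
  side-cross {p} {v} {u} {u₁} pv uu₁ s s₁ with u ≟ v
  ... | yes refl = refl , sym (dist≡0⇒≡ (n≤0⇒n≡0 (≤-pred (≤-trans s₁
        (subst (λ d → dist u u₁ ≤ suc d) (dist-refl u₁) (dist-adj u₁ uu₁))))))
  ... | no u≢v with towards u v u≢v
  ...   | u⁻ , uu⁻ , step = contradiction closer (<⇒≱ farther)
    where
    u₁≤ : dist v u₁ ≤ dist p u
    u₁≤ = begin
      dist v u₁       ≡⟨ dist-sym v u₁ ⟩
      dist u₁ v       ≤⟨ dist-adj v (adj-sym G uu₁) ⟩
      suc (dist u v)  ≡⟨ cong suc (dist-sym u v) ⟩
      suc (dist v u)  ≤⟨ s ⟩
      dist p u        ∎
      where open ≤-Reasoning
    u₁-side : Side u u₁ p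
    u₁-side = subst₂ _<_ (dist-sym p u₁) (dist-sym p u) (≤-trans s₁ u₁≤)
    u⁻-side : Side u u⁻ p
    u⁻-side = begin-strict
      dist u⁻ p         ≡⟨ dist-sym u⁻ p ⟩
      dist p u⁻         ≤⟨ dist-adj u⁻ pv ⟩
      suc (dist v u⁻)   ≡⟨ cong suc (dist-sym v u⁻) ⟩
      suc (dist u⁻ v)   ≡⟨ step ⟩
      dist u v          ≡⟨ dist-sym u v ⟩
      dist v u          <⟨ s ⟩
      dist p u          ≡⟨ dist-sym p u ⟩
      dist u p          ∎
      where open ≤-Reasoning
    u₁≡u⁻ : u₁ ≡ u⁻
    u₁≡u⁻ = side-unique uu₁ uu⁻ u₁-side u⁻-side
    closer : dist p u ≤ dist v u
    closer = begin
      dist p u          ≡⟨ dist-sym p u ⟩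
      dist u p          ≤⟨ dist-adj p uu₁ ⟩
      suc (dist u₁ p)   ≡⟨ cong suc (dist-sym u₁ p) ⟩
      suc (dist p u₁)   ≤⟨ s₁ ⟩
      dist v u₁         ≡⟨ cong (dist v) u₁≡u⁻ ⟩
      dist v u⁻         ≡⟨ dist-sym v u⁻ ⟩
      dist u⁻ v         ≤⟨ n≤1+n _ ⟩
      suc (dist u⁻ v)   ≡⟨ step ⟩
      dist u v          ≡⟨ dist-sym u v ⟩
      dist v u          ∎
      where open ≤-Reasoning
    farther : dist v u < dist p u
    farther = s

  -- By `side-cross`, a walk between the two sides first changes sides along the edge `vp`, so it
  -- contains a walk to `v`, this edge, and a walk from `p`.
  separation : ∀ {p v u u′} → Adj G p v → Side p v u → Side v p u′ →
               suc (dist v u + dist p u′) ≤ dist u u′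
  separation {p} {v} {u} {u′} pv s s′ = go (geodesic u u′) s
    where
    go : ∀ {k x} → Walk G k x u′ → Side p v x → suc (dist v x + dist p u′) ≤ k
    go [] s = contradiction s′ (<-asym s)
    go {x = x} (_∷_ {k} {v = y} e w) s with side-⊎ y pv
    ... | inj₁ sy = s≤s (≤-trans (+-monoˡ-≤ (dist p u′)
            (subst₂ (λ i j → i ≤ suc j) (dist-sym x v) (dist-sym y v) (dist-adj v e))) (go w sy))
    ... | inj₂ sy with side-cross pv e s sy
    ...   | refl , refl rewrite dist-refl v = s≤s (dist-≤ w)

  size-complement : ∀ {v w} → Adj G v w → size v w + size w v ≡ n
  size-complement {v} {w} e = trans
    (sym (count-⊎ (side? v w) (side? w v) (λ _ → yes tt)
      (λ u _ → side-⊎ u e) (λ _ _ → tt) (λ _ _ → tt) (λ _ → <-asym)))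
    (count-all n)


  -- A vertex `t` on neither side would be cut off from `y` by the edge at `u` and from `u` by the
  -- edge at `y`; `separation` then gives `dist u t < dist y t < dist u t`.
  side-opposite : ∀ {y y⁺ u u⁺} → Adj G y y⁺ → Adj G u u⁺ → Side y y⁺ u → Side u u⁺ y →
                  ∀ t → Side u u⁺ t ⊎ Side y y⁺ t
  side-opposite {y} {y⁺} {u} {u⁺} yy⁺ uu⁺ su sy t with side-⊎ t uu⁺ | side-⊎ t yy⁺
  ... | inj₁ s | _      = inj₁ s
  ... | inj₂ _ | inj₁ s = inj₂ s
  ... | inj₂ s | inj₂ s′ = contradiction (≤-trans
          (≤-trans (s≤s (m≤n+m (dist u t) (dist u⁺ y))) (separation uu⁺ sy s))
          (≤-trans (n≤1+n _) (≤-trans (s≤s (m≤n+m (dist y t) (dist y⁺ u))) (separation yy⁺ su s′))))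
        (<-irrefl refl)

  size-opposite : ∀ {y y⁺ u u⁺} → Adj G y y⁺ → Adj G u u⁺ → Side y y⁺ u → Side u u⁺ y →
                  n ≤ size u u⁺ + size y y⁺
  size-opposite yy⁺ uu⁺ su sy = count-cover (side? _ _) (side? _ _) (side-opposite yy⁺ uu⁺ su sy)

-- Center, branches and centroid of a tree

comprehension : ∀ {n} {P : Pred (Fin n) 0ℓ} → Decidable P → Subset n
comprehension P? = tabulate (does ∘ P?)

module _ {n : ℕ} {P : Pred (Fin n) 0ℓ} (P? : Decidable P) where

  ∈-comprehension⁺ : ∀ {x} → P x → x ∈ comprehension P?
  ∈-comprehension⁺ {x} px = lookup⇒[]= x _ (trans (lookup∘tabulate (does ∘ P?) x) (dec-true (P? x) px))

  ∈-comprehension⁻ : ∀ {x} → x ∈ comprehension P? → P x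
  ∈-comprehension⁻ {x} x∈
    with P? x | trans (sym (lookup∘tabulate (does ∘ P?) x)) ([]=⇒lookup x∈)
  ... | yes px | _ = px
  ... | no _   | ()

count≡1⇒∃! : ∀ {n} {P : Pred (Fin n) 0ℓ} (P? : Decidable P) → count P? ≡ 1 →
             ∃[ v ] P v × (∀ x → P x → x ≡ v)
count≡1⇒∃! {n} P? one = go (filter P? (allFin n)) one (∈-count⁻ P?) (∈-count⁺ P?)
  where
  go : ∀ xs → length xs ≡ 1 → (∀ {x} → x ∈ₗ xs → _) → (∀ {x} → _ → x ∈ₗ xs) → _
  go (v ∷ []) _ sound complete = v , sound (here refl) , λ x px → only (complete px)
    where
    only : ∀ {x} → x ∈ₗ v ∷ [] → x ≡ v
    only (here eq) = eq

-- Matches the convention of `edgeCount`, which lists an edge once, with its smaller end first.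
sortPair : ∀ {n} → Fin n → Fin n → Fin n × Fin n
sortPair a b with a <ᶠ? b
... | yes _ = a , b
... | no _  = b , a

sortPair-⊎ : ∀ {n} (a b : Fin n) → a ≢ b →
             (sortPair a b ≡ (a , b) × a <ᶠ b) ⊎ (sortPair a b ≡ (b , a) × b <ᶠ a)
sortPair-⊎ a b a≢b with a <ᶠ? b
... | yes a<b = inj₁ (refl , a<b)
... | no  a≮b with Finₚ.<-cmp a b
...   | tri< a<b _ _ = contradiction a<b a≮b
...   | tri≈ _ a≡b _ = contradiction a≡b a≢b
...   | tri> _ _ b<a = inj₂ (refl , b<a)

module Centers {n : ℕ} (G : Graph n) (conn : Connected G) where

  open Metric G conn

  eccentricity : ∀ v → ∃ (IsEccentricity G v)
  eccentricity v with maximiser (λ _ → yes tt) (λ u → dist u v) (v , tt)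
  ... | x , _ , maximal = dist x v , (x , isDistance x v) ,
    λ d (u , isD) → subst (_≤ dist x v) (sym (dist-unique isD)) (maximal u tt)

  dist-≤-ecc : ∀ {v e} → IsEccentricity G v e → ∀ u → dist u v ≤ e
  dist-≤-ecc isE u = proj₂ isE _ (u , isDistance u _)

  ecc-≤ : ∀ {v e E} → IsEccentricity G v e → (∀ u → dist u v ≤ E) → e ≤ E
  ecc-≤ ((u , isD) , _) bound = subst (_≤ _) (sym (dist-unique isD)) (bound u)

  center-dist-≤ : ∀ {x y E} → (∀ u → dist u x ≤ E) → Center G y → ∀ u → dist u y ≤ E
  center-dist-≤ {x} bound (e , isE , minimal) u = ≤-trans (dist-≤-ecc isE u)
    (≤-trans (minimal x _ (proj₂ (eccentricity x))) (ecc-≤ (proj₂ (eccentricity x)) bound))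

  -- Every vertex is at distance at least half of `dist z₁ z₂` from one of `z₁` and `z₂`, so no
  -- eccentricity is below this half, and `E` is the half rounded up at most.
  center-criterion : ∀ {x E} z₁ z₂ → (∀ u → dist u x ≤ E) → E + E ≤ suc (dist z₁ z₂) → Center G x
  center-criterion {x} {E} z₁ z₂ bound long with eccentricity x
  ... | e , isE = e , isE , λ u f isF → ≤-trans (ecc-≤ isE bound) (a+a≤1+b+b⇒a≤b (begin
    E + E                         ≤⟨ long ⟩
    suc (dist z₁ z₂)              ≤⟨ s≤s (triangle z₁ u z₂) ⟩
    suc (dist z₁ u + dist u z₂)   ≡⟨ cong (λ d → suc (dist z₁ u + d)) (dist-sym u z₂) ⟩
    suc (dist z₁ u + dist z₂ u)   ≤⟨ s≤s (+-mono-≤ (dist-≤-ecc isF z₁) (dist-≤-ecc isF z₂)) ⟩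
    suc (f + f)                   ∎))
    where open ≤-Reasoning

module Branches {n : ℕ} (G : Graph n) (conn : Connected G) (bridges : AllBridges G) where

  open Tree G conn bridges

  InBranch : Fin n → Fin n → Pred (Fin n) 0ℓ
  InBranch v w u = u ≡ v ⊎ Side v w u

  inBranch? : ∀ v w u → Dec (InBranch v w u)
  inBranch? v w u = (u ≟ v) ⊎-dec side? v w u

  branch : Fin n → Fin n → Subset n
  branch v w = comprehension (inBranch? v w)

  module _ {v w : Fin n} where

    ∈-branch⁺ : ∀ {u} → InBranch v w u → u ∈ branch v w
    ∈-branch⁺ = ∈-comprehension⁺ (inBranch? v w)

    ∈-branch⁻ : ∀ {u} → u ∈ branch v w → InBranch v w u
    ∈-branch⁻ = ∈-comprehension⁻ (inBranch? v w)

    ∈-branch-≢ : ∀ {u} → u ∈ branch v w → u ≢ v → Side v w u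
    ∈-branch-≢ u∈ u≢v with ∈-branch⁻ u∈
    ... | inj₁ u≡v = contradiction u≡v u≢v
    ... | inj₂ s   = s

  parent-∈-branch : ∀ {v w u y} → Adj G v w → Adj G u y → Side v w u → InBranch v w y
  parent-∈-branch {y = y} vw uy s with side-⊎ y vw
  ... | inj₁ sy = inj₂ sy
  ... | inj₂ sy = inj₁ (proj₂ (side-cross vw uy s sy))

  branch-isSubtreeWithPendant : ∀ {v w} → Adj G v w → IsSubtreeWithPendant G v (branch v w)
  branch-isSubtreeWithPendant {v} {w} vw = ((v , v∈) , connected) , v∈ , pendant
    where
    B = branch v w
    v∈ : v ∈ B
    v∈ = ∈-branch⁺ (inj₁ refl)
    toRoot : ∀ k u → dist u v ≡ k → u ∈ B → ∃[ j ] Walk (induced G B) j u v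
    toRoot zero    u d≡ _ with refl ← dist≡0⇒≡ d≡ = 0 , []
    toRoot (suc k) u d≡ u∈ with towards u v (λ { refl → 0≢1+n (trans (sym (dist-refl v)) d≡) })
    ... | y , uy , step
      with y∈ ← ∈-branch⁺ (parent-∈-branch vw uy (∈-branch-≢ u∈ λ { refl →
                            0≢1+n (trans (sym (dist-refl v)) d≡) }))
      with j , walk ← toRoot k y (suc-injective (trans step d≡)) y∈
      = suc j , (u∈ , y∈ , uy) ∷ walk
    connected : ∀ u u′ → u ∈ B → u′ ∈ B → ∃[ k ] Walk (induced G B) k u u′
    connected u u′ u∈ u′∈ = _ , (proj₂ (toRoot _ u refl u∈) ++ʷ reverseʷ (proj₂ (toRoot _ u′ refl u′∈)))
    pendant : IsPendant (induced G B) v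
    pendant = count-singleton (adj? (induced G B) v) w (v∈ , ∈-branch⁺ (inj₂ (side-self vw)) , vw)
      λ { x (_ , x∈ , vx) → side-unique vx vw (side-self vx) (∈-branch-≢ x∈ (adj⇒≢ vx ∘ sym)) }

  -- A walk inside `S` from `u` to `v` can leave the side containing `u` only through the neighbour
  -- of `v` on that side. So this neighbour belongs to `S`, and `v` has a single neighbour there.
  subtreeWithPendant-⊆-branch : ∀ {v S} → IsSubtreeWithPendant G v S →
    ∃[ w ] Adj G v w × w ∈ S × S ⊆ branch v w
  subtreeWithPendant-⊆-branch {v} {S} ((_ , connected) , v∈ , pendant)
    with count≡1⇒∃! (adj? (induced G S) v) pendant
  ... | w , (_ , w∈ , vw) , only = w , vw , w∈ , sub
    where
    exit : ∀ {w′ k u} → Adj G v w′ → Walk (induced G S) k u v → Side v w′ u → w′ ∈ S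
    exit vw′ [] s = contradiction refl (side⇒≢ s)
    exit vw′ (_∷_ {v = y} (u∈ , _ , uy) walk) s with side-⊎ y vw′
    ... | inj₁ sy = exit vw′ walk sy
    ... | inj₂ sy = subst (_∈ S) (proj₁ (side-cross vw′ uy s sy)) u∈
    sub : S ⊆ branch v w
    sub {u} u∈ with u ≟ v
    ... | yes u≡v = ∈-branch⁺ (inj₁ u≡v)
    ... | no  u≢v with towards v u (u≢v ∘ sym)
    ...   | w′ , vw′ , step
      with w′∈ ← exit vw′ (proj₂ (connected u v u∈ v∈)) (≤-reflexive step)
      with refl ← only w′ (v∈ , w′∈ , vw′)
      = ∈-branch⁺ (inj₂ (≤-reflexive step))

  isBranch⇒branch : ∀ {v B} → IsBranch G v B → ∃[ w ] Adj G v w × B ≡ branch v w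
  isBranch⇒branch (sub , maximal) with subtreeWithPendant-⊆-branch sub
  ... | w , vw , _ , B⊆ = w , vw , ⊆-antisym B⊆ (maximal _ (branch-isSubtreeWithPendant vw) B⊆)

  branch-isBranch : ∀ {v w} → Adj G v w → IsBranch G v (branch v w)
  branch-isBranch {v} {w} vw = branch-isSubtreeWithPendant vw , maximal
    where
    maximal : ∀ S → IsSubtreeWithPendant G v S → branch v w ⊆ S → S ⊆ branch v w
    maximal S sub ⊆S with subtreeWithPendant-⊆-branch sub
    ... | w′ , vw′ , w′∈ , S⊆
      with refl ← side-unique vw vw′ (side-self vw)
                    (∈-branch-≢ (S⊆ (⊆S (∈-branch⁺ (inj₂ (side-self vw))))) (adj⇒≢ vw ∘ sym))
      = S⊆

  -- Edges of the branch correspond to its vertices other than v: an edge goes to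
  -- its end farther from v.
  edgeCount-branch : ∀ {v w} → Adj G v w → edgeCount (induced G (branch v w)) ≡ size v w
  edgeCount-branch {v} {w} vw = trans {j = length edges} refl (≤-antisym
      (length-injection (λ (x , y) → farther x y) {xs = edges} {ys = filter (side? v w) (allFin n)}
        (Uniqueₚ.filter⁺ E? (Uniqueₚ.cartesianProduct⁺ (Uniqueₚ.allFin⁺ n) (Uniqueₚ.allFin⁺ n)))
        (λ e∈ → ∈-count⁺ (side? v w) (farther-side (edge⁻ e∈)))
        (λ e∈ e′∈ → farther-injective (edge⁻ e∈) (edge⁻ e′∈)))
      (length-injection (λ u → sortPair u (parent u)) {xs = filter (side? v w) (allFin n)} {ys = edges}
        (unique-count (side? v w))
        (λ u∈ → parent-edge (∈-count⁻ (side? v w) u∈))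
        (λ u∈ u′∈ → parent-injective (∈-count⁻ (side? v w) u∈) (∈-count⁻ (side? v w) u′∈))))
    where
    B = branch v w
    H = induced G B

    E : Pred (Fin n × Fin n) 0ℓ
    E (x , y) = x <ᶠ y × Adj H x y

    E? : Decidable E
    E? (x , y) = (x <ᶠ? y) ×-dec adj? H x y

    edges : List (Fin n × Fin n)
    edges = filter E? (cartesianProduct (allFin n) (allFin n))

    edge⁻ : ∀ {e} → e ∈ₗ edges → E e
    edge⁻ e∈ = proj₂ (∈-filter⁻ E? {xs = cartesianProduct (allFin n) (allFin n)} e∈)

    edge⁺ : ∀ {e} → E e → e ∈ₗ edges
    edge⁺ = ∈-filter⁺ E? (∈-cartesianProduct⁺ (∈-allFin _) (∈-allFin _))

    farther : Fin n → Fin n → Fin n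
    farther x y with dist x v <? dist y v
    ... | yes _ = y
    ... | no _  = x

    farther-⊎ : ∀ {x y} → Adj G x y → (farther x y ≡ y × Side y x v) ⊎ (farther x y ≡ x × Side x y v)
    farther-⊎ {x} {y} xy with dist x v <? dist y v | side-⊎ v xy
    ... | yes x<y | _       = inj₁ (refl , x<y)
    ... | no  x≮y | inj₁ s = inj₂ (refl , s)
    ... | no  x≮y | inj₂ s = contradiction s x≮y

    far-side : ∀ {x y : Fin n} → y ∈ B → Side y x v → Side v w y
    far-side y∈ s = ∈-branch-≢ y∈ (side⇒≢ s ∘ sym)

    farther-side : ∀ {x y} → E (x , y) → Side v w (farther x y)
    farther-side {x} {y} (_ , x∈ , y∈ , xy) with farther-⊎ xy
    ... | inj₁ (eq , s) rewrite eq = far-side y∈ s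
    ... | inj₂ (eq , s) rewrite eq = far-side x∈ s

    farther-injective : ∀ {x y x′ y′} → E (x , y) → E (x′ , y′) →
                        farther x y ≡ farther x′ y′ → (x , y) ≡ (x′ , y′)
    farther-injective {x} {y} {x′} {y′} (x<y , _ , _ , xy) (x<y′ , _ , _ , xy′) same
      with farther-⊎ xy | farther-⊎ xy′
    ... | inj₁ (eq , s) | inj₁ (eq′ , s′)
      with refl ← trans (sym eq) (trans same eq′)
      = cong (_, y) (side-unique (adj-sym G xy) (adj-sym G xy′) s s′)
    ... | inj₁ (eq , s) | inj₂ (eq′ , s′)
      with refl ← trans (sym eq) (trans same eq′)
      with refl ← side-unique (adj-sym G xy) xy′ s s′
      = contradiction x<y (Finₚ.<-asym x<y′)
    ... | inj₂ (eq , s) | inj₁ (eq′ , s′)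
      with refl ← trans (sym eq) (trans same eq′)
      with refl ← side-unique xy (adj-sym G xy′) s s′
      = contradiction x<y (Finₚ.<-asym x<y′)
    ... | inj₂ (eq , s) | inj₂ (eq′ , s′)
      with refl ← trans (sym eq) (trans same eq′)
      = cong (x ,_) (side-unique xy xy′ s s′)

    parent : Fin n → Fin n
    parent u with u ≟ v
    ... | yes _   = u
    ... | no  u≢v = proj₁ (towards u v u≢v)

    parent-spec : ∀ {u} → u ≢ v → Adj G u (parent u) × Side u (parent u) v
    parent-spec {u} u≢v with u ≟ v
    ... | yes u≡v  = contradiction u≡v u≢v
    ... | no  u≢v′ with towards u v u≢v′
    ...   | _ , uy , step = uy , ≤-reflexive step

    parent-edge : ∀ {u} → Side v w u → sortPair u (parent u) ∈ₗ edges
    parent-edge {u} s with parent-spec (side⇒≢ s)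
    ... | up , _ with sortPair-⊎ u (parent u) (adj⇒≢ up)
    ...   | inj₁ (eq , lt) rewrite eq = edge⁺
              (lt , ∈-branch⁺ (inj₂ s) , ∈-branch⁺ (parent-∈-branch vw up s) , up)
    ...   | inj₂ (eq , lt) rewrite eq = edge⁺
              (lt , ∈-branch⁺ (parent-∈-branch vw up s) , ∈-branch⁺ (inj₂ s) , adj-sym G up)

    parent-injective : ∀ {u u′} → Side v w u → Side v w u′ →
                       sortPair u (parent u) ≡ sortPair u′ (parent u′) → u ≡ u′
    parent-injective {u} {u′} s s′ same with parent-spec (side⇒≢ s) | parent-spec (side⇒≢ s′)
    ... | up , c | up′ , c′
      with sortPair-⊎ u (parent u) (adj⇒≢ up) | sortPair-⊎ u′ (parent u′) (adj⇒≢ up′)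
    ...   | inj₁ (eq , _) | inj₁ (eq′ , _) = ,-injectiveˡ (trans (sym eq) (trans same eq′))
    ...   | inj₂ (eq , _) | inj₂ (eq′ , _) = ,-injectiveʳ (trans (sym eq) (trans same eq′))
    ...   | inj₁ (eq , _) | inj₂ (eq′ , _) = swapped c c′ (trans (sym eq) (trans same eq′))
      where
      swapped : ∀ {a b a′ b′} → Side a b v → Side a′ b′ v → (a , b) ≡ (b′ , a′) → a ≡ a′
      swapped c c′ refl = contradiction c (<-asym c′)
    ...   | inj₂ (eq , _) | inj₁ (eq′ , _) = swapped c c′ (trans (sym eq) (trans same eq′))
      where
      swapped : ∀ {a b a′ b′} → Side a b v → Side a′ b′ v → (b , a) ≡ (a′ , b′) → a ≡ a′
      swapped c c′ refl = contradiction c (<-asym c′)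

  size-≤-weight : ∀ {v w x} → IsWeight G v x → Adj G v w → size v w ≤ x
  size-≤-weight isW vw = proj₂ isW _ (_ , branch-isBranch vw , edgeCount-branch vw)

  branch-size : ∀ {v B k} → IsBranch G v B → edgeCount (induced G B) ≡ k → ∃[ w ] Adj G v w × k ≡ size v w
  branch-size isB count≡ =
    let (w , vw , B≡) = isBranch⇒branch isB
    in w , vw , trans (sym count≡)
         (trans (cong (λ B → edgeCount (induced G B)) B≡) (edgeCount-branch vw))

  weight-attained : ∀ {v x} → IsWeight G v x → ∃[ w ] Adj G v w × x ≡ size v w
  weight-attained ((B , isB , count≡) , _) = branch-size isB count≡

  weight : ∀ v → ∃ (Adj G v) → ∃ (IsWeight G v)
  weight v neighbour =
    let (w , vw , maximal) = maximiser (adj? G v) (size v) neighbour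
    in size v w
     , (branch v w , branch-isBranch vw , edgeCount-branch vw)
     , λ k (B , isB , count≡) →
         let (w′ , vw′ , k≡) = branch-size isB count≡
         in subst (_≤ size v w) (sym k≡) (maximal w′ vw′)

  Light : Fin n → Set
  Light y = ∀ {w} → Adj G y w → size y w + size y w ≤ n

  -- The side of `u` towards `y` and the side of `y` towards `u` cover the tree. The latter holds at
  -- most half of the vertices, so the former holds at least half, which no side at `y` exceeds.
  light⇒size-least : ∀ {y w u} → Light y → Adj G y w → u ≢ y → ∃[ u⁺ ] Adj G u u⁺ × size y w ≤ size u u⁺
  light⇒size-least {y} {w} {u} light yw u≢y with towards u y u≢y | towards y u (u≢y ∘ sym)
  ... | u⁺ , uu⁺ , su | y⁺ , yy⁺ , sy = u⁺ , uu⁺ , a+a≤1+b+b⇒a≤b (m≤n⇒m≤1+n (begin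
      size y w + size y w     ≤⟨ light yw ⟩
      n                       ≤⟨ opposite ⟩
      size u u⁺ + size y y⁺   ≤⟨ +-monoʳ-≤ (size u u⁺) (+-cancelʳ-≤ (size y y⁺) (size y y⁺) (size u u⁺)
                                   (≤-trans (light yy⁺) opposite)) ⟩
      size u u⁺ + size u u⁺   ∎))
    where
    open ≤-Reasoning
    opposite : n ≤ size u u⁺ + size y y⁺
    opposite = size-opposite yy⁺ uu⁺ (≤-reflexive sy) (≤-reflexive su)

  centroid-criterion : ∀ {y} → ∃ (Adj G y) → Light y → Centroid G y
  centroid-criterion {y} neighbour light =
    let (W , isW) = weight y neighbour
        (w , yw , W≡) = weight-attained isW
    in W , isW , λ u x isX → subst (_≤ x) (sym W≡) (least-size u x isX yw (u ≟ y))
    where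
    least-size : ∀ u x → IsWeight G u x → ∀ {w} → Adj G y w → Dec (u ≡ y) → size y w ≤ x
    least-size u x isX yw (yes u≡y) =
      size-≤-weight (subst (λ v → IsWeight G v x) u≡y isX) yw
    least-size u x isX yw (no u≢y) =
      let (u⁺ , uu⁺ , y≤u) = light⇒size-least light yw u≢y
      in ≤-trans y≤u (size-≤-weight isX uu⁺)

  -- The weight of a centroid is at most that of the light vertex `y`. This controls all centroids
  -- at once, as a lower bound on the set distance requires.
  centroid-light : ∀ {y u} → ∃ (Adj G y) → Light y → Centroid G u → Light u
  centroid-light {y} {u} neighbour light (x , isX , minimal) {w} uw =
    let (W , isW) = weight y neighbour
        (w′ , yw′ , W≡) = weight-attained isW
        u≤ = ≤-trans (size-≤-weight isX uw) (≤-trans (minimal y W isW) (≤-reflexive W≡))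
    in ≤-trans (+-mono-≤ u≤ u≤) (light yw′)

-- Shapes of rooted binary trees

data Shape : Set where
  leaf : Shape
  node : Shape → Shape → Shape

order : Shape → ℕ
order leaf       = 1
order (node s t) = suc (order s + order t)

height : Shape → ℕ
height leaf       = 0
height (node s t) = suc (height s ⊔ height t)

data LeafDepth : Shape → ℕ → Set where
  here  : LeafDepth leaf 0
  left  : ∀ {s t k} → LeafDepth s k → LeafDepth (node s t) (suc k)
  right : ∀ {s t k} → LeafDepth t k → LeafDepth (node s t) (suc k)

leafDepth-height : ∀ t → LeafDepth t (height t)
leafDepth-height leaf = here
leafDepth-height (node s t) with ⊔-sel (height s) (height t)
... | inj₁ eq rewrite eq = left (leafDepth-height s)
... | inj₂ eq rewrite eq = right (leafDepth-height t)

-- The shapes of a binary caterpillar seen from an end of its spine, with `k` vertices of degree 3;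
-- the derivation records on which side the spine continues.
data Comb : ℕ → Shape → Set where
  end   : Comb 0 leaf
  left  : ∀ {k t} → Comb k t → Comb (suc k) (node t leaf)
  right : ∀ {k t} → Comb k t → Comb (suc k) (node leaf t)

comb-order : ∀ {k t} → Comb k t → order t ≡ suc (k + k)
comb-order end = refl
comb-order {suc k} (left {t = t} c) rewrite comb-order c | +-suc k k | +-comm (k + k) 1 = refl
comb-order {suc k} (right c) rewrite comb-order c | +-suc k k = refl

comb-height : ∀ {k t} → Comb k t → height t ≡ k
comb-height end = refl
comb-height {suc k} (left c) rewrite comb-height c | ⊔-identityʳ k = refl
comb-height (right c) rewrite comb-height c = refl

-- The part of G on v's side of the edge pv, seen from v, has shape t.
data Hang {n} (G : Graph n) : Fin n → Fin n → Shape → Set where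
  leaf : ∀ {p v} → Adj G p v → (∀ {w} → Adj G v w → w ≡ p) → Hang G p v leaf
  node : ∀ {p v a b s t} → Adj G p v → a ≢ p → b ≢ p → a ≢ b →
         (∀ {w} → Adj G v w → w ≡ p ⊎ w ≡ a ⊎ w ≡ b) →
         Hang G v a s → Hang G v b t → Hang G p v (node s t)

hang-adj : ∀ {n} {G : Graph n} {p v t} → Hang G p v t → Adj G p v
hang-adj (leaf pv _)           = pv
hang-adj (node pv _ _ _ _ _ _) = pv

module _ {n : ℕ} {P : Pred (Fin n) 0ℓ} (P? : Decidable P) where

  count≡2⇒pair : count P? ≡ 2 → ∃[ a ] ∃[ b ] P a × P b × a ≢ b × (∀ x → P x → x ≡ a ⊎ x ≡ b)
  count≡2⇒pair two = go (filter P? (allFin n)) two (unique-count P?) (∈-count⁻ P?) (∈-count⁺ P?)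
    where
    go : ∀ xs → length xs ≡ 2 → Unique xs → (∀ {x} → x ∈ₗ xs → P x) → (∀ {x} → P x → x ∈ₗ xs) →
         ∃[ a ] ∃[ b ] P a × P b × a ≢ b × (∀ x → P x → x ≡ a ⊎ x ≡ b)
    go (a ∷ b ∷ []) _ ((a≢b ∷ []) ∷ _) sound complete =
      a , b , sound (here refl) , sound (there (here refl)) , a≢b , λ x px → split (complete px)
      where
      split : ∀ {x} → x ∈ₗ a ∷ b ∷ [] → x ≡ a ⊎ x ≡ b
      split (here eq)         = inj₁ eq
      split (there (here eq)) = inj₂ eq

  Others : Fin n → Set
  Others p = ∃[ a ] ∃[ b ] P a × P b × a ≢ p × b ≢ p × a ≢ b × (∀ {x} → P x → x ≡ p ⊎ x ≡ a ⊎ x ≡ b)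

  count≡3⇒others : count P? ≡ 3 → ∀ {p} → P p → Others p
  count≡3⇒others three {p} pp =
    go (filter P? (allFin n)) three (unique-count P?) (∈-count⁻ P?) (∈-count⁺ P?)
    where
    go : ∀ xs → length xs ≡ 3 → Unique xs → (∀ {x} → x ∈ₗ xs → P x) → (∀ {x} → P x → x ∈ₗ xs) → Others p
    go (x ∷ y ∷ z ∷ []) _ ((x≢y ∷ x≢z ∷ []) ∷ (y≢z ∷ []) ∷ _) sound complete = pick (complete pp)
      where
      px = sound (here refl)
      py = sound (there (here refl))
      pz = sound (there (there (here refl)))
      pick : p ∈ₗ x ∷ y ∷ z ∷ [] → Others p
      pick (here refl) = y , z , py , pz , x≢y ∘ sym , x≢z ∘ sym , y≢z , λ q → split (complete q)
        where
        split : ∀ {u} → u ∈ₗ x ∷ y ∷ z ∷ [] → u ≡ x ⊎ u ≡ y ⊎ u ≡ z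
        split (here eq)                 = inj₁ eq
        split (there (here eq))         = inj₂ (inj₁ eq)
        split (there (there (here eq))) = inj₂ (inj₂ eq)
      pick (there (here refl)) = x , z , px , pz , x≢y , y≢z ∘ sym , x≢z , λ q → split (complete q)
        where
        split : ∀ {u} → u ∈ₗ x ∷ y ∷ z ∷ [] → u ≡ y ⊎ u ≡ x ⊎ u ≡ z
        split (here eq)                 = inj₂ (inj₁ eq)
        split (there (here eq))         = inj₁ eq
        split (there (there (here eq))) = inj₂ (inj₂ eq)
      pick (there (there (here refl))) = x , y , px , py , x≢z , y≢z , x≢y , λ q → split (complete q)
        where
        split : ∀ {u} → u ∈ₗ x ∷ y ∷ z ∷ [] → u ≡ z ⊎ u ≡ x ⊎ u ≡ y
        split (here eq)                 = inj₂ (inj₁ eq)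
        split (there (here eq))         = inj₂ (inj₂ eq)
        split (there (there (here eq))) = inj₁ eq

module Hangs {n : ℕ} (G : Graph n) (conn : Connected G) (bridges : AllBridges G) where

  open Tree G conn bridges

  module _ {R : Pred (Fin n) 0ℓ} (R? : Decidable R) {v a b : Fin n}
           (va : Adj G v a) (vb : Adj G v b) (a≢b : a ≢ b) where

    count-children : (∀ u → R u → u ≢ v → Side v a u ⊎ Side v b u) → R v →
                     (∀ u → Side v a u → R u) → (∀ u → Side v b u → R u) →
                     count R? ≡ suc (size v a + size v b)
    count-children split rv sub-a sub-b = trans
      (count-⊎ (_≟ v) below? R? split′ (λ { u refl → rv }) join (λ { u refl → v-not-below }))
      (cong₂ _+_ (count-singleton (_≟ v) v refl λ _ eq → eq)
        (count-⊎ (side? v a) (side? v b) below? (λ _ → id) (λ _ → inj₁) (λ _ → inj₂)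
          λ u sa sb → a≢b (side-unique va vb sa sb)))
      where
      Below : Pred (Fin n) 0ℓ
      Below u = Side v a u ⊎ Side v b u
      below? : Decidable Below
      below? u = side? v a u ⊎-dec side? v b u
      split′ : ∀ u → R u → u ≡ v ⊎ Below u
      split′ u ru with u ≟ v
      ... | yes u≡v = inj₁ u≡v
      ... | no  u≢v = inj₂ (split u ru u≢v)
      join : ∀ u → Below u → R u
      join u (inj₁ s) = sub-a u s
      join u (inj₂ s) = sub-b u s
      v-not-below : ¬ Below v
      v-not-below (inj₁ s) = side⇒≢ s refl
      v-not-below (inj₂ s) = side⇒≢ s refl

  side-cases : ∀ {p v a b u} → (∀ {w} → Adj G v w → w ≡ p ⊎ w ≡ a ⊎ w ≡ b) →
               Side p v u → u ≢ v → Side v a u ⊎ Side v b u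
  side-cases nbrs s u≢v with side-split s u≢v
  ... | w , vw , w≢p , sw with nbrs vw
  ...   | inj₁ w≡p         = contradiction w≡p w≢p
  ...   | inj₂ (inj₁ refl) = inj₁ sw
  ...   | inj₂ (inj₂ refl) = inj₂ sw

  side-only : ∀ {p v u} → (∀ {w} → Adj G v w → w ≡ p) → Side p v u → u ≡ v
  side-only {v = v} {u} only s with u ≟ v
  ... | yes u≡v = u≡v
  ... | no  u≢v with side-split s u≢v
  ...   | w , vw , w≢p , _ = contradiction (only vw) w≢p

  size-node : ∀ {p v a b} → Adj G p v → Adj G v a → Adj G v b → a ≢ p → b ≢ p → a ≢ b →
              (∀ {w} → Adj G v w → w ≡ p ⊎ w ≡ a ⊎ w ≡ b) → size p v ≡ suc (size v a + size v b)
  size-node pv va vb a≢p b≢p a≢b nbrs = count-children (side? _ _) va vb a≢b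
    (λ u → side-cases nbrs) (side-self pv) (λ u → side-extend pv va a≢p) (λ u → side-extend pv vb b≢p)

  size-root : ∀ {v a b} → Adj G v a → Adj G v b → a ≢ b → (∀ {w} → Adj G v w → w ≡ a ⊎ w ≡ b) →
              n ≡ suc (size v a + size v b)
  size-root {v} {a} {b} va vb a≢b nbrs = trans (sym (count-all n))
    (count-children (λ _ → yes tt) va vb a≢b split tt (λ _ _ → tt) (λ _ _ → tt))
    where
    split : ∀ u → _ → u ≢ v → Side v a u ⊎ Side v b u
    split u _ u≢v with towards v u (u≢v ∘ sym)
    ... | w , vw , step with nbrs vw
    ...   | inj₁ refl = inj₁ (≤-reflexive step)
    ...   | inj₂ refl = inj₂ (≤-reflexive step)

  size-leaf : ∀ {p v} → Adj G p v → (∀ {w} → Adj G v w → w ≡ p) → size p v ≡ 1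
  size-leaf pv only = count-singleton (side? _ _) _ (side-self pv) λ _ → side-only only

  hang-size : ∀ {p v t} → Hang G p v t → size p v ≡ order t
  hang-size (leaf pv only) = size-leaf pv only
  hang-size (node pv a≢p b≢p a≢b nbrs hs ht) =
    trans (size-node pv (hang-adj hs) (hang-adj ht) a≢p b≢p a≢b nbrs)
          (cong suc (cong₂ _+_ (hang-size hs) (hang-size ht)))

  side-step′ : ∀ {v w u} → Adj G v w → Side v w u → dist u v ≡ suc (dist u w)
  side-step′ {v} {w} {u} vw s = trans (dist-sym u v) (trans (side-step vw s) (cong suc (dist-sym w u)))

  hang-height : ∀ {p v t u} → Hang G p v t → Side p v u → dist u v ≤ height t
  hang-height {v = v} (leaf _ only) s with refl ← side-only only s = ≤-reflexive (dist-refl v)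
  hang-height {v = v} {u = u} (node {s = σ} {τ} _ _ _ _ nbrs hs ht) s with u ≟ v
  ... | yes refl = ≤-trans (≤-reflexive (dist-refl v)) z≤n
  ... | no  u≢v with side-cases nbrs s u≢v
  ...   | inj₁ sa rewrite side-step′ (hang-adj hs) sa = s≤s (≤-trans (hang-height hs sa) (m≤m⊔n (height σ) _))
  ...   | inj₂ sb rewrite side-step′ (hang-adj ht) sb = s≤s (≤-trans (hang-height ht sb) (m≤n⊔m (height σ) _))

  hang-leaf : ∀ {p v t k} → Hang G p v t → LeafDepth t k →
              ∃[ u ] IsPendant G u × Side p v u × dist u v ≡ k
  hang-leaf {p} {v} (leaf pv only) here = v
    , count-singleton (adj? G v) p (adj-sym G pv) (λ _ → only) , side-self pv , dist-refl v
  hang-leaf (node pv a≢p _ _ _ hs _) (left d) with hang-leaf hs d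
  ... | u , pendant , s , refl = u , pendant , side-extend pv (hang-adj hs) a≢p s , side-step′ (hang-adj hs) s
  hang-leaf (node pv _ b≢p _ _ _ ht) (right d) with hang-leaf ht d
  ... | u , pendant , s , refl = u , pendant , side-extend pv (hang-adj ht) b≢p s , side-step′ (hang-adj ht) s

  -- The number `k` is fuel: the sides of the two children are strictly smaller than the side of
  -- their parent.
  hang-exists : ∀ k {p v} → size p v ≤ k → Adj G p v →
                (∀ {u} → Side p v u → degree G u ≡ 1 ⊎ degree G u ≡ 3) → ∃ (Hang G p v)
  hang-exists k {p} {v} size≤ pv degrees with degrees (side-self pv)
  ... | inj₁ one with count≡1⇒∃! (adj? G v) one
  ...   | _ , _ , only = leaf , leaf pv λ vw → trans (only _ vw) (sym (only p (adj-sym G pv)))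
  hang-exists k {p} {v} size≤ pv degrees | inj₂ three
    with count≡3⇒others (adj? G v) three (adj-sym G pv)
  ... | a , b , va , vb , a≢p , b≢p , a≢b , nbrs
    with k | subst (_≤ k) (size-node pv va vb a≢p b≢p a≢b nbrs) size≤
  ...   | suc k′ | s≤s size≤′
    with hang-exists k′ (≤-trans (m≤m+n _ _) size≤′) va (degrees ∘ side-extend pv va a≢p)
       | hang-exists k′ (≤-trans (m≤n+m _ _) size≤′) vb (degrees ∘ side-extend pv vb b≢p)
  ...     | s , hs | t , ht = node s t , node pv a≢p b≢p a≢b nbrs hs ht

-- Binary caterpillars

module Avoiding {n : ℕ} (G : Graph n) where

  deleteVertex : Fin n → Graph n
  deleteVertex v = record
    { Adj        = λ x y → Adj G x y × x ≢ v × y ≢ v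
    ; adj?       = λ x y → adj? G x y ×-dec (¬? (x ≟ v) ×-dec ¬? (y ≟ v))
    ; adj-sym    = λ (e , x≢v , y≢v) → adj-sym G e , y≢v , x≢v
    ; adj-irrefl = λ (e , _) → adj-irrefl G e
    }

  -- Membership in the same component after deletion of the vertex `v`.
  Joined : Fin n → Fin n → Fin n → Set
  Joined v x y = x ≢ v × y ≢ v × ∃[ k ] Walk (deleteVertex v) k x y

  joined-refl : ∀ {v x} → x ≢ v → Joined v x x
  joined-refl x≢v = x≢v , x≢v , 0 , []

  joined-sym : ∀ {v x y} → Joined v x y → Joined v y x
  joined-sym (x≢v , y≢v , k , w) = y≢v , x≢v , k , reverseʷ w

  joined-trans : ∀ {v x y z} → Joined v x y → Joined v y z → Joined v x z
  joined-trans (x≢v , _ , _ , w) (_ , z≢v , _ , w′) = x≢v , z≢v , _ , (w ++ʷ w′)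

  joined-step : ∀ {v x y} → Adj G x y → x ≢ v → y ≢ v → Joined v x y
  joined-step e x≢v y≢v = x≢v , y≢v , 1 , (e , x≢v , y≢v) ∷ []

  joined-along : ∀ {v k s e x} (w : Walk G k s e) → v ∉ₗ vertices w → x ∈ₗ vertices w → Joined v x e
  joined-along []      v∉ (here refl) = joined-refl λ { refl → v∉ (here refl) }
  joined-along (a ∷ w) v∉ (here refl) = joined-trans
    (joined-step a (λ { refl → v∉ (here refl) }) (λ { refl → v∉ (there (start∈ w)) }))
    (joined-along w (v∉ ∘ there) (start∈ w))
  joined-along (a ∷ w) v∉ (there x∈)  = joined-along w (v∉ ∘ there) x∈

  -- Deleting `v` leaves at most two pieces of the path, and each piece contains an end.
  joined-to-ends : ∀ {k s e} (w : Walk G k s e) → IsPath w → ∀ v {x} → x ∈ₗ vertices w → x ≢ v →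
                   Joined v x s ⊎ Joined v x e
  joined-to-ends []      p v (here refl) x≢v = inj₁ (joined-refl x≢v)
  joined-to-ends {s = s} (a ∷ w) (s∉ ∷ p) v x∈ x≢v with s ≟ v | x∈
  ... | yes refl | here refl = contradiction refl x≢v
  ... | yes refl | there x∈w = inj₂ (joined-along w (λ s∈ → All.lookup s∉ s∈ refl) x∈w)
  ... | no  s≢v  | here refl = inj₁ (joined-refl s≢v)
  ... | no  s≢v  | there x∈w with joined-to-ends w p v x∈w x≢v
  ...   | inj₁ j = inj₁ (joined-trans j (joined-step (adj-sym G a) (proj₁ (proj₂ j)) s≢v))
  ...   | inj₂ j = inj₂ j

  neighbours-not-joined : AllBridges G → ∀ {v x y} → Adj G v x → Adj G v y → x ≢ y → ¬ Joined v x y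
  neighbours-not-joined bridges {v} {x} {y} vx vy x≢y j = bridges vx
    ( (vy , (λ (_ , y≡x) → x≢y (sym y≡x)) , (λ { (refl , _) → adj-irrefl G vx }))
    ∷ mapʷ keep (proj₂ (proj₂ (proj₂ (joined-sym j)))))
    where
    keep : ∀ {u w} → Adj (deleteVertex v) u w → Adj (deleteEdge G v x) u w
    keep (e , u≢v , w≢v) = e , u≢v ∘ proj₁ , w≢v ∘ proj₂

module Caterpillar {n : ℕ} (G : Graph n) (conn : Connected G) (bridges : AllBridges G)
                   (binary : ∀ v → ¬ IsPendant G v → degree G v ≡ 3) where

  open Tree G conn bridges
  open Centers G conn
  open Hangs G conn bridges
  open Avoiding G

  degrees : ∀ v → degree G v ≡ 1 ⊎ degree G v ≡ 3
  degrees v with degree G v ≟ⁿ 1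
  ... | yes one = inj₁ one
  ... | no  ¬one = inj₂ (binary v ¬one)

  pendant-unique : ∀ {v x y} → IsPendant G v → Adj G v x → Adj G v y → x ≡ y
  pendant-unique {v} pendant vx vy with count≡1⇒∃! (adj? G v) pendant
  ... | _ , _ , only = trans (only _ vx) (sym (only _ vy))

  neighbour : ∀ v → ∃ (Adj G v)
  neighbour v = go (filter (adj? G v) (allFin n)) (∈-count⁻ (adj? G v)) (degrees v)
    where
    go : ∀ xs → (∀ {x} → x ∈ₗ xs → Adj G v x) → length xs ≡ 1 ⊎ length xs ≡ 3 → ∃ (Adj G v)
    go (x ∷ _) sound _ = x , sound (here refl)
    go [] _ (inj₁ ())
    go [] _ (inj₂ ())

  another : ∀ {v p} → ¬ IsPendant G v → Adj G v p → ∃[ a ] Adj G v a × a ≢ p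
  another {v} ¬pendant vp with count≡3⇒others (adj? G v) (binary v ¬pendant) vp
  ... | a , _ , va , _ , a≢p , _ = a , va , a≢p

  hang-node-¬pendant : ∀ {p v s t} → Hang G p v (node s t) → ¬ IsPendant G v
  hang-node-¬pendant (node pv a≢p _ _ _ hs _) pendant =
    a≢p (pendant-unique pendant (hang-adj hs) (adj-sym G pv))

  farthest-pair : ∀ {c} → HasMaximumEccentricity G c → ∃[ z ] ∀ x y → dist x y ≤ dist z c
  farthest-pair (E , ((z , isD) , _) , maximal) = z , λ x y →
    subst (dist x y ≤_) (dist-unique isD)
      (≤-trans (dist-≤-ecc (proj₂ (eccentricity y)) x) (maximal y _ (proj₂ (eccentricity y))))

  module _ {k s e} (w : Walk G k s e) (path : IsPath w)
           (dominating : ∀ x → x ∉ₗ vertices w → ∃[ y ] (y ∈ₗ vertices w × Adj G x y)) where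

    -- If `x` were off the path, it would have a neighbour `y` on the path and a second neighbour
    -- `z` on or next to the path. The path avoids `x`, so it would join `y` and `z` without `x`,
    -- although deleting `x` separates its neighbours.
    ¬pendant⇒∈ : ∀ {x} → ¬ IsPendant G x → x ∈ₗ vertices w
    ¬pendant⇒∈ {x} ¬pendant with any? (x ≟_) (vertices w)
    ... | yes x∈ = x∈
    ... | no  x∉ with dominating x x∉
    ...   | y , y∈ , xy with another ¬pendant xy
    ...     | z , xz , z≢y = contradiction
              (joined-trans z-joined (joined-sym (joined-along w x∉ y∈)))
              (neighbours-not-joined bridges xz xy z≢y)
      where
      z-joined : Joined x z e
      z-joined with any? (z ≟_) (vertices w)
      ... | yes z∈ = joined-along w x∉ z∈
      ... | no  z∉ with dominating z z∉
      ...   | y′ , y′∈ , zy′ = joined-trans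
                (joined-step zy′ (adj⇒≢ xz ∘ sym) (λ { refl → x∉ y′∈ })) (joined-along w x∉ y′∈)

    -- Pigeonhole: all three neighbours lie on the path, so after deletion of `v` two of them are
    -- joined to the same end of it, hence to each other.
    ¬three-¬pendant : ∀ {v a b c} → Adj G v a → Adj G v b → Adj G v c → a ≢ b → a ≢ c → b ≢ c →
                      ¬ IsPendant G a → ¬ IsPendant G b → ¬ IsPendant G c → ⊥
    ¬three-¬pendant {v} va vb vc a≢b a≢c b≢c na nb nc
      with joined-to-ends w path v (¬pendant⇒∈ na) (adj⇒≢ va ∘ sym)
         | joined-to-ends w path v (¬pendant⇒∈ nb) (adj⇒≢ vb ∘ sym)
         | joined-to-ends w path v (¬pendant⇒∈ nc) (adj⇒≢ vc ∘ sym)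
    ... | inj₁ ja | inj₁ jb | _       =
        neighbours-not-joined bridges va vb a≢b (joined-trans ja (joined-sym jb))
    ... | inj₁ ja | inj₂ _  | inj₁ jc =
        neighbours-not-joined bridges va vc a≢c (joined-trans ja (joined-sym jc))
    ... | inj₁ _  | inj₂ jb | inj₂ jc =
        neighbours-not-joined bridges vb vc b≢c (joined-trans jb (joined-sym jc))
    ... | inj₂ _  | inj₁ jb | inj₁ jc =
        neighbours-not-joined bridges vb vc b≢c (joined-trans jb (joined-sym jc))
    ... | inj₂ ja | inj₁ _  | inj₂ jc =
        neighbours-not-joined bridges va vc a≢c (joined-trans ja (joined-sym jc))
    ... | inj₂ ja | inj₂ jb | _       =
        neighbours-not-joined bridges va vb a≢b (joined-trans ja (joined-sym jb))

    hang-comb : ∀ {p v t} → ¬ IsPendant G p → Hang G p v t → ∃[ j ] Comb j t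
    hang-comb np (leaf _ _) = 0 , end
    hang-comb np h@(node {t = leaf} _ _ _ _ _ hs _) with hang-comb (hang-node-¬pendant h) hs
    ... | j , comb = suc j , left comb
    hang-comb np h@(node {s = leaf} {t = node _ _} _ _ _ _ _ _ ht) with hang-comb (hang-node-¬pendant h) ht
    ... | j , comb = suc j , right comb
    hang-comb np (node {s = node _ _} {t = node _ _} pv a≢p b≢p a≢b _ hs ht) = ⊥-elim
      (¬three-¬pendant (adj-sym G pv) (hang-adj hs) (hang-adj ht) (a≢p ∘ sym) (b≢p ∘ sym) a≢b
        np (hang-node-¬pendant hs) (hang-node-¬pendant ht))

    module _ {c : Fin n} (extremal : HasMaximumEccentricity G c) where

      private
        z = proj₁ (farthest-pair extremal)
        longest = proj₂ (farthest-pair extremal)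

      -- A longest path from c ends at z; entering it at p from b instead of from c
      -- gives no longer path.
      reroute : ∀ {p a b} → Adj G p a → Side p a z → Side a p b → dist p b ≤ dist p c
      reroute {p} {a} {b} pa sz sb = +-cancelˡ-≤ (dist a z) _ _ (≤-pred (begin
        suc (dist a z + dist p b)   ≤⟨ separation pa sz sb ⟩
        dist z b                    ≤⟨ longest z b ⟩
        dist z c                    ≤⟨ triangle z p c ⟩
        dist z p + dist p c         ≡⟨ cong (_+ dist p c) (side-step′ pa sz) ⟩
        suc (dist z a) + dist p c   ≡⟨ cong (λ d → suc d + dist p c) (dist-sym z a) ⟩
        suc (dist a z + dist p c)   ∎))
        where open ≤-Reasoning

      sibling-side : ∀ {p a b} → Adj G p a → Adj G p b → a ≢ b → Side a p b
      sibling-side pa pb a≢b = side-¬ pa λ s → a≢b (side-unique pa pb s (side-self pb))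

      z≢c : z ≢ c
      z≢c z≡c with neighbour c
      ... | x , cx = n≮0 (≤-trans (n≢0⇒n>0 {dist x c} (adj⇒≢ cx ∘ sym ∘ dist≡0⇒≡))
        (≤-trans (longest x c) (≤-reflexive (trans (cong (λ u → dist u c) z≡c) (dist-refl c)))))

      -- If `c` had another neighbour besides the one towards `z`, a longest path could be prolonged
      -- beyond `c`.
      pendant-end : IsPendant G c
      pendant-end with degrees c
      ... | inj₁ one   = one
      ... | inj₂ three with towards c z (z≢c ∘ sym)
      ...   | x , cx , step with count≡3⇒others (adj? G c) three cx
      ...     | y , _ , cy , _ , y≢x , _ = contradiction
                (≤-trans (reroute cx (≤-reflexive step) (sibling-side cx cy (y≢x ∘ sym)))
                  (≤-reflexive (dist-refl c)))
                (<⇒≱ (n≢0⇒n>0 (adj⇒≢ cy ∘ dist≡0⇒≡)))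

      -- At `e` the argument of `hang-comb` fails because the parent `c` is pendant. Extremality of
      -- `c` replaces it: if both children of `e` had children, the longest path from `c` would pass
      -- through one of them, and ending it below the other instead of at `c` would lengthen it.
      hang-from-end : ∀ {e t} → Hang G c e t → ∃[ j ] Comb j t
      hang-from-end (leaf _ _) = 0 , end
      hang-from-end h@(node {t = leaf} _ _ _ _ _ hs _) with hang-comb (hang-node-¬pendant h) hs
      ... | j , comb = suc j , left comb
      hang-from-end h@(node {s = leaf} {t = node _ _} _ _ _ _ _ _ ht) with hang-comb (hang-node-¬pendant h) ht
      ... | j , comb = suc j , right comb
      hang-from-end (node {v = e} {a} {b} {node _ _} {node _ _} ce a≢c b≢c a≢b nbrs hs ht) = ⊥-elim absurd
        where
        beyond : ∀ {x s} → Hang G e x s → ¬ IsPendant G x → x ≢ c → ∃[ y ] Side e x y × dist e y ≡ 2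
        beyond hx nx x≢c with another nx (adj-sym G (hang-adj hx))
        ... | y , xy , y≢e =
          let s = side-extend (hang-adj hx) xy y≢e (side-self xy) in
          y , s , trans (side-step (hang-adj hx) s)
            (cong suc (trans (side-step xy (side-self xy)) (cong suc (dist-refl y))))
        e-c : dist e c ≤ 1
        e-c = subst (λ d → dist e c ≤ suc d) (dist-refl c) (dist-adj c (adj-sym G ce))
        not-past : ∀ {x y s} → Adj G e x → Side e x z → Hang G e y s → ¬ IsPendant G y → x ≢ y → y ≢ c → ⊥
        not-past ex sx hy ny x≢y y≢c with beyond hy ny y≢c
        ... | u , su , d≡2 = <⇒≱ (subst (1 <_) (sym d≡2) ≤-refl)
              (≤-trans (reroute ex sx (side-¬ ex λ sxu → x≢y (side-unique ex (hang-adj hy) sxu su))) e-c)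
        z-side : Side c e z
        z-side with towards c z (z≢c ∘ sym)
        ... | e′ , ce′ , step with refl ← pendant-unique pendant-end ce ce′ = ≤-reflexive step
        z≢e : z ≢ e
        z≢e z≡e = <⇒≱ (s≤s (n≢0⇒n>0 {dist e a} (adj⇒≢ (hang-adj hs) ∘ dist≡0⇒≡)))
          (≤-trans (≤-reflexive (trans
            (sym (side-step ce (side-extend ce (hang-adj hs) a≢c (side-self (hang-adj hs))))) (dist-sym c a)))
            (≤-trans (longest a c) (subst (λ u → dist u c ≤ 1) (sym z≡e) e-c)))
        absurd : ⊥
        absurd with side-cases nbrs z-side z≢e
        ... | inj₁ sa = not-past (hang-adj hs) sa ht (hang-node-¬pendant ht) a≢b b≢c
        ... | inj₂ sb = not-past (hang-adj ht) sb hs (hang-node-¬pendant hs) (a≢b ∘ sym) a≢c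

      caterpillar-shape : ∃[ e ] ∃[ t ] ∃[ j ] Hang G c e t × Comb j t × (∀ {x} → Adj G c x → x ≡ e)
      caterpillar-shape with count≡1⇒∃! (adj? G c) pendant-end
      ... | e , ce , only with hang-exists (size c e) ≤-refl ce (λ {u} _ → degrees u)
      ...   | t , h with hang-from-end h
      ...     | j , comb = e , t , j , h , comb , λ {x} → only x

-- Structure of crg trees

-- Condition (i) of rgood trees, read off the shape.
Balanced : Shape → Set
Balanced t = ∀ {j k} → LeafDepth t j → LeafDepth t k → ∣ j - k ∣ ≤ 1

module RootedTree {n : ℕ} (G : Graph n) (conn : Connected G) (bridges : AllBridges G) where

  open Tree G conn bridges
  open Hangs G conn bridges

  rooted-shape : ∀ {r} → 3 ≤ n → IsRootedBinaryTree G r → Rooted.IsRgood G r →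
    ∃[ a ] ∃[ b ] ∃[ s ] ∃[ t ] Hang G r a s × Hang G r b t × a ≢ b ×
      (∀ {w} → Adj G r w → w ≡ a ⊎ w ≡ b) × n ≡ order (node s t) × Balanced (node s t)
  rooted-shape 3≤n (_ , inj₁ refl) _ = contradiction 3≤n λ { (s≤s ()) }
  rooted-shape {r} _ (_ , inj₂ (two , degrees)) (close , _)
    with count≡2⇒pair (adj? G r) two
  ... | a , b , ra , rb , a≢b , nbrs
    with hang-exists _ ≤-refl ra (λ s → degrees _ (side⇒≢ s))
       | hang-exists _ ≤-refl rb (λ s → degrees _ (side⇒≢ s))
  ...   | s , hs | t , ht = a , b , s , t , hs , ht , a≢b , (λ {w} → nbrs w)
        , trans (size-root ra rb a≢b (λ {w} → nbrs w)) (cong suc (cong₂ _+_ (hang-size hs) (hang-size ht)))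
        , balanced
    where
    pendant-at : ∀ {k} → LeafDepth (node s t) k → ∃[ u ] IsPendant G u × IsDistance G r u k
    pendant-at (left d) with hang-leaf hs d
    ... | u , pendant , su , refl = u , pendant ,
          subst (IsDistance G r u) (trans (dist-sym r u) (side-step′ ra su)) (isDistance r u)
    pendant-at (right d) with hang-leaf ht d
    ... | u , pendant , su , refl = u , pendant ,
          subst (IsDistance G r u) (trans (dist-sym r u) (side-step′ rb su)) (isDistance r u)
    balanced : Balanced (node s t)
    balanced d d′ =
      let (u , pu , lu) = pendant-at d
          (v , pv , lv) = pendant-at d′
      in close pu pv lu lv

caterpillar-shape-at : ∀ {n} {G : Graph n} {c} → IsBinaryCaterpillar G → HasMaximumEccentricity G c →
  ∃[ e ] ∃[ t ] ∃[ p ] Hang G c e t × Comb p t × (∀ {x} → Adj G c x → x ≡ e) × n ≡ suc (suc (p + p))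
caterpillar-shape-at {n} {G} {c} (((conn , acyclic) , binary) , k , u , v , w , path , dominating) extremal =
  let bridges = acyclic⇒allBridges G acyclic
      (e , t , p , h , comb , only) =
        Caterpillar.caterpillar-shape G conn bridges binary w path dominating extremal
  in e , t , p , h , comb , only , (begin
    n                                 ≡⟨ sym (Tree.size-complement G conn bridges (hang-adj h)) ⟩
    Tree.size G conn bridges c e + Tree.size G conn bridges e c
                                      ≡⟨ cong₂ _+_ (Hangs.hang-size G conn bridges h)
                                           (Hangs.size-leaf G conn bridges (adj-sym G (hang-adj h)) only) ⟩
    order t + 1                       ≡⟨ cong (_+ 1) (comb-order comb) ⟩
    suc (p + p) + 1                   ≡⟨ +-comm (suc (p + p)) 1 ⟩
    suc (suc (p + p))                 ∎)
  where open ≡-Reasoning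

-- Identification of two graphs at a vertex

flip : ∀ {k l n} {G : Graph k} {x} {H : Graph l} {y} {T : Graph n} →
       IsIdentification G x H y T → IsIdentification H y G x T
flip I = record
  { ι₁ = ι₂ ; ι₂ = ι₁ ; ι₁-injective = ι₂-injective ; ι₂-injective = ι₁-injective
  ; covering  = Sum.swap ∘ covering
  ; glued     = mk⇔ (swap ∘ Equivalence.to glued ∘ sym) (sym ∘ Equivalence.from glued ∘ swap)
  ; adjacency = mk⇔ (Sum.swap ∘ Equivalence.to adjacency) (Equivalence.from adjacency ∘ Sum.swap)
  } where open IsIdentification I

module Gluing {k l n : ℕ} {G : Graph k} {x : Fin k} {H : Graph l} {y : Fin l} {T : Graph n}
              (I : IsIdentification G x H y T) where

  open IsIdentification I

  hub : ι₁ x ≡ ι₂ y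
  hub = Equivalence.from glued (refl , refl)

  ι₁-adj : ∀ {a b} → Adj G a b → Adj T (ι₁ a) (ι₁ b)
  ι₁-adj e = Equivalence.from adjacency (inj₁ (_ , _ , refl , refl , e))

  retract : Fin n → Fin k
  retract v = [ proj₁ , const x ]′ (covering v)

  retract-ι₁ : ∀ a → retract (ι₁ a) ≡ a
  retract-ι₁ a with covering (ι₁ a)
  ... | inj₁ (_ , eq) = ι₁-injective eq
  ... | inj₂ (_ , eq) = sym (proj₁ (Equivalence.to glued (sym eq)))

  retract-ι₂ : ∀ b → retract (ι₂ b) ≡ x
  retract-ι₂ b with covering (ι₂ b)
  ... | inj₁ (_ , eq) = proj₁ (Equivalence.to glued eq)
  ... | inj₂ _        = refl

  -- Collapsing the copy of `H` onto the common vertex keeps the edges of `G` and contracts the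
  -- others, so a walk that misses an edge of `G` is sent to a walk that still misses it.
  retractʷ : ∀ {a a′ j u v} → Walk (deleteEdge T (ι₁ a) (ι₁ a′)) j u v →
             ∃[ i ] Walk (deleteEdge G a a′) i (retract u) (retract v)
  retractʷ [] = 0 , []
  retractʷ {a} {a′} {v = v} ((e , ¬aa′ , ¬a′a) ∷ w) with Equivalence.to adjacency e | retractʷ w
  ... | inj₁ (c , d , refl , refl , cd) | i , w′ rewrite retract-ι₁ c | retract-ι₁ d = suc i
        , (cd , (λ { (refl , refl) → ¬aa′ (refl , refl) }) , (λ { (refl , refl) → ¬a′a (refl , refl) })) ∷ w′
  ... | inj₂ (c , d , refl , refl , _) | i , w′ =
        i , subst (λ z → Walk (deleteEdge G a a′) i z (retract v))
              (trans (retract-ι₂ d) (sym (retract-ι₂ c))) w′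

  bridge₁ : AllBridges G → ∀ {a a′} → Adj G a a′ → ∀ {j} → ¬ Walk (deleteEdge T (ι₁ a) (ι₁ a′)) j (ι₁ a) (ι₁ a′)
  bridge₁ bridges {a} {a′} aa′ w with retractʷ w
  ... | i , w′ rewrite retract-ι₁ a | retract-ι₁ a′ = bridges aa′ w′

  toHub₁ : Connected G → ∀ a → ∃[ j ] Walk T j (ι₁ a) (ι₁ x)
  toHub₁ conn a = _ , mapʷ ι₁-adj (proj₂ (conn a x))

  neighbours₁ : ∀ {v w} → v ≢ x → Adj T (ι₁ v) w → ∃[ b ] ι₁ b ≡ w × Adj G v b
  neighbours₁ v≢x e with Equivalence.to adjacency e
  ... | inj₁ (c , d , eq , refl , cd) rewrite ι₁-injective eq = d , refl , cd
  ... | inj₂ (c , d , eq , _)         = contradiction (proj₁ (Equivalence.to glued (sym eq))) v≢x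

  neighbours-hub : ∀ {w} → Adj T (ι₁ x) w →
                   (∃[ b ] ι₁ b ≡ w × Adj G x b) ⊎ (∃[ b ] ι₂ b ≡ w × Adj H y b)
  neighbours-hub e with Equivalence.to adjacency e
  ... | inj₁ (c , d , eq , refl , cd) rewrite ι₁-injective eq = inj₁ (d , refl , cd)
  ... | inj₂ (c , d , eq , refl , cd) rewrite ι₂-injective (trans eq hub) = inj₂ (d , refl , cd)

  module _ (conn : Connected G) (bridges : AllBridges G) where

    open Tree G conn bridges

    -- Gluing gives new neighbours only to the common vertex, so a part of `G` that avoids `x` keeps
    -- its shape.
    hang₁ : ∀ {p v t} → Hang G p v t → ¬ Side p v x → Hang T (ι₁ p) (ι₁ v) t
    hang₁ {v = v} (leaf pv only) x∉ = leaf (ι₁-adj pv) only′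
      where
      only′ : ∀ {w} → Adj T (ι₁ v) w → w ≡ ι₁ _
      only′ e with neighbours₁ (λ { refl → x∉ (side-self pv) }) e
      ... | b , refl , vb = cong ι₁ (only vb)
    hang₁ {p = p} {v} (node {a = a} {b} pv a≢p b≢p a≢b nbrs hs ht) x∉ =
      node (ι₁-adj pv) (a≢p ∘ ι₁-injective) (b≢p ∘ ι₁-injective) (a≢b ∘ ι₁-injective) nbrs′
        (hang₁ hs (x∉ ∘ side-extend pv (hang-adj hs) a≢p))
        (hang₁ ht (x∉ ∘ side-extend pv (hang-adj ht) b≢p))
      where
      nbrs′ : ∀ {w} → Adj T (ι₁ v) w → w ≡ ι₁ p ⊎ w ≡ ι₁ a ⊎ w ≡ ι₁ b
      nbrs′ e with neighbours₁ (λ { refl → x∉ (side-self pv) }) e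
      ... | _ , refl , vw = Sum.map (cong ι₁) (Sum.map (cong ι₁) (cong ι₁)) (nbrs vw)

    hang-at-hub : ∀ {v t} → Hang G x v t → Hang T (ι₁ x) (ι₁ v) t
    hang-at-hub h = hang₁ h (λ s → side⇒≢ s refl)

module _ {k l n : ℕ} {G : Graph k} {x : Fin k} {H : Graph l} {y : Fin l} {T : Graph n}
         (I : IsIdentification G x H y T) where

  open IsIdentification I

  private
    module I₁ = Gluing I
    module I₂ = Gluing (flip I)

  glued-connected : Connected G → Connected H → Connected T
  glued-connected connG connH u v =
    _ , (proj₂ (toHub u) ++ʷ reverseʷ (proj₂ (toHub v)))
    where
    toHub : ∀ u → ∃[ j ] Walk T j u (ι₁ x)
    toHub u with covering u
    ... | inj₁ (a , refl) = I₁.toHub₁ connG a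
    ... | inj₂ (b , refl) rewrite I₁.hub = I₂.toHub₁ connH b

  glued-allBridges : AllBridges G → AllBridges H → AllBridges T
  glued-allBridges bridgesG bridgesH e w with Equivalence.to adjacency e
  ... | inj₁ (_ , _ , refl , refl , ab) = I₁.bridge₁ bridgesG ab w
  ... | inj₂ (_ , _ , refl , refl , ab) = I₂.bridge₁ bridgesH ab w

-- c carries the two subtrees s and t of the rgood tree and, through e, the
-- caterpillar, which has p further vertices of degree 3.
record Anatomy {n : ℕ} (T : Graph n) (p : ℕ) (s t : Shape) : Set where
  field
    {c a b e} : Fin n
    {tail}    : Shape
    comb      : Comb p tail
    hang-a    : Hang T c a s
    hang-b    : Hang T c b t
    hang-e    : Hang T c e tail
    a≢b       : a ≢ b
    a≢e       : a ≢ e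
    b≢e       : b ≢ e
    nbrs      : ∀ {w} → Adj T c w → w ≡ e ⊎ w ≡ a ⊎ w ≡ b

crg-anatomy : ∀ {n l} {T : Graph n} → 3 ≤ l → IsCrg n l T →
  Connected T × AllBridges T × ∃[ p ] ∃[ s ] ∃[ t ] Anatomy T p s t ×
    l ≡ order (node s t) × Balanced (node s t) × n ∸ l + 1 ≡ suc (suc (p + p))
crg-anatomy {n} {l} {T} 3≤l (C , c , R , r , caterpillar , extremal , (rooted , rgood) , I) =
  let (connC , acyclicC) = proj₁ (proj₁ caterpillar)
      (connR , acyclicR) = proj₁ rooted
      bridgesC = acyclic⇒allBridges C acyclicC
      bridgesR = acyclic⇒allBridges R acyclicR
      (e , τ , p , he , comb , only , n≡) = caterpillar-shape-at caterpillar extremal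
      (a , b , s , t , ha , hb , a≢b , nbrs , l≡ , balanced) =
        RootedTree.rooted-shape R connR bridgesR 3≤l rooted rgood
  in glued-connected I connC connR , glued-allBridges I bridgesC bridgesR , p , s , t
   , record
     { comb   = comb
     ; hang-a = at-hub (Gluing.hang-at-hub (flip I) connR bridgesR ha)
     ; hang-b = at-hub (Gluing.hang-at-hub (flip I) connR bridgesR hb)
     ; hang-e = Gluing.hang-at-hub I connC bridgesC he
     ; a≢b    = a≢b ∘ ι₂-injective
     ; a≢e    = apart (hang-adj he)
     ; b≢e    = apart (hang-adj he)
     ; nbrs   = λ cw → neighbours only nbrs (Gluing.neighbours-hub I cw)
     }
   , l≡ , balanced , n≡
  where
  open IsIdentification I
  at-hub : ∀ {v t} → Hang T (ι₂ r) v t → Hang T (ι₁ c) v t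
  at-hub {v} {t} = subst (λ h → Hang T h v t) (sym (Gluing.hub I))
  apart : ∀ {e v} → Adj C c e → ι₂ v ≢ ι₁ e
  apart ce eq = adj-irrefl C (subst (Adj C c) (proj₁ (Equivalence.to glued (sym eq))) ce)
  neighbours : ∀ {e a b w} → (∀ {x} → Adj C c x → x ≡ e) → (∀ {x} → Adj R r x → x ≡ a ⊎ x ≡ b) →
    (∃[ x ] ι₁ x ≡ w × Adj C c x) ⊎ (∃[ x ] ι₂ x ≡ w × Adj R r x) → w ≡ ι₁ e ⊎ w ≡ ι₂ a ⊎ w ≡ ι₂ b
  neighbours only nbrs (inj₁ (_ , refl , cx)) = inj₁ (cong ι₁ (only cx))
  neighbours only nbrs (inj₂ (_ , refl , rx)) = inj₂ (Sum.map (cong ι₂) (cong ι₂) (nbrs rx))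

-- Order and height of balanced shapes

Deep : ℕ → Shape → Set
Deep k t = ∀ {j} → LeafDepth t j → k ≤ j

deep-left : ∀ {k s t} → Deep (suc k) (node s t) → Deep k s
deep-left deep d = ≤-pred (deep (left d))

deep-right : ∀ {k s t} → Deep (suc k) (node s t) → Deep k t
deep-right deep d = ≤-pred (deep (right d))

order-positive : ∀ t → 1 ≤ order t
order-positive leaf       = s≤s z≤n
order-positive (node s t) = s≤s z≤n

2^-suc : ∀ k → 2 ^ suc k ≡ 2 ^ k + 2 ^ k
2^-suc k = cong (2 ^ k +_) (+-identityʳ (2 ^ k))

-- All levels down to `k` are full.
order-≥ : ∀ k t → Deep k t → 2 ^ suc k ≤ suc (order t)
order-≥ zero    t          _    = s≤s (order-positive t)
order-≥ (suc k) leaf       deep = contradiction (deep here) λ ()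
order-≥ (suc k) (node s t) deep = begin
  2 ^ suc (suc k)               ≡⟨ 2^-suc (suc k) ⟩
  2 ^ suc k + 2 ^ suc k         ≤⟨ +-mono-≤ (order-≥ k s (deep-left deep)) (order-≥ k t (deep-right deep)) ⟩
  suc (order s) + suc (order t) ≡⟨ +-suc (suc (order s)) (order t) ⟩
  suc (order (node s t))        ∎
  where open ≤-Reasoning

order-≤ : ∀ k t → height t ≤ k → suc (order t) ≤ 2 ^ suc k
order-≤ k leaf _ = *-monoʳ-≤ 2 (m^n>0 2 k)
order-≤ (suc k) (node s t) (s≤s low) = begin
  suc (order (node s t))        ≡⟨ sym (+-suc (suc (order s)) (order t)) ⟩
  suc (order s) + suc (order t) ≤⟨ +-mono-≤ (order-≤ k s (≤-trans (m≤m⊔n _ _) low))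
                                            (order-≤ k t (≤-trans (m≤n⊔m (height s) _) low)) ⟩
  2 ^ suc k + 2 ^ suc k         ≡⟨ sym (2^-suc (suc k)) ⟩
  2 ^ suc (suc k)               ∎
  where open ≤-Reasoning

-- The full levels down to `k` contribute `2 ^ suc k ∸ 1` vertices, and a level below them at least
-- two more.
order-> : ∀ k t → Deep k t → k < height t → 2 ^ suc k < order t
order-> zero (node s t) _ _ = s≤s (+-mono-≤ (order-positive s) (order-positive t))
order-> (suc k) (node s t) deep (s≤s high) with ⊔-sel (height s) (height t)
... | inj₁ eq = begin-strict
  2 ^ suc (suc k)               ≡⟨ 2^-suc (suc k) ⟩
  2 ^ suc k + 2 ^ suc k         <⟨ +-mono-<-≤ (order-> k s (deep-left deep) (subst (suc k ≤_) eq high))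
                                              (order-≥ k t (deep-right deep)) ⟩
  order s + suc (order t)       ≡⟨ +-suc (order s) (order t) ⟩
  order (node s t)              ∎
  where open ≤-Reasoning
... | inj₂ eq = begin-strict
  2 ^ suc (suc k)               ≡⟨ 2^-suc (suc k) ⟩
  2 ^ suc k + 2 ^ suc k         <⟨ +-mono-≤-< (order-≥ k s (deep-left deep))
                                              (order-> k t (deep-right deep) (subst (suc k ≤_) eq high)) ⟩
  order (node s t)              ∎
  where open ≤-Reasoning

balanced-deep : ∀ {s t} → Balanced (node s t) → Deep (height s ⊔ height t) (node s t)
balanced-deep {s} {t} balanced {j} d = ≤-pred (begin
  suc k                 ≤⟨ m≤n+∣m-n∣ (suc k) j ⟩
  j + ∣ suc k - j ∣     ≤⟨ +-monoʳ-≤ j (balanced (leafDepth-height (node s t)) d) ⟩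
  j + 1                 ≡⟨ +-comm j 1 ⟩
  suc j                 ∎)
  where
  open ≤-Reasoning
  k = height s ⊔ height t

-- 2^k ≤ q < 2^(k+1) determines the height k + 1 of the rgood tree on 2q + 1 vertices.
balanced-range : ∀ {s t q} → Balanced (node s t) → order s + order t ≡ q + q →
                 2 ^ (height s ⊔ height t) ≤ q × q < 2 ^ suc (height s ⊔ height t)
balanced-range {s} {t} {q} balanced orders =
    a+a≤1+b+b⇒a≤b′ (begin
      2 ^ k + 2 ^ k      ≡⟨ sym (2^-suc k) ⟩
      2 ^ suc k          ≤⟨ ≤-pred (order-> k (node s t) (balanced-deep balanced) ≤-refl) ⟩
      order s + order t  ≡⟨ orders ⟩
      q + q              ∎)
  , a+a≤1+b+b⇒a≤b′ (begin
      suc q + suc q                 ≡⟨ +-suc (suc q) q ⟩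
      suc (suc (q + q))             ≡⟨ cong (λ m → suc (suc m)) (sym orders) ⟩
      suc (order (node s t))        ≤⟨ order-≤ (suc k) (node s t) ≤-refl ⟩
      2 ^ suc (suc k)               ≡⟨ 2^-suc (suc k) ⟩
      2 ^ suc k + 2 ^ suc k         ∎)
  where
  open ≤-Reasoning
  k = height s ⊔ height t
  a+a≤1+b+b⇒a≤b′ : ∀ {a b} → a + a ≤ b + b → a ≤ b
  a+a≤1+b+b⇒a≤b′ = a+a≤1+b+b⇒a≤b ∘ m≤n⇒m≤1+n

n<2^n : ∀ n → n < 2 ^ n
n<2^n zero    = s≤s z≤n
n<2^n (suc n) = subst (suc (suc n) ≤_) (sym (2^-suc n)) (+-mono-≤ (m^n>0 2 n) (n<2^n n))

half : ∀ m → ∃[ i ] i + i ≤ m × m ≤ suc (i + i)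
half zero          = 0 , z≤n , z≤n
half (suc zero)    = 0 , z≤n , ≤-refl
half (suc (suc m)) with half m
... | i , lo , hi = suc i , subst (_≤ suc (suc m)) (cong suc (sym (+-suc i i))) (s≤s (s≤s lo))
                  , subst (λ k → suc (suc m) ≤ suc k) (cong suc (sym (+-suc i i))) (s≤s (s≤s hi))

-- Rounds the spine positions of center and centroid: `b` will be the height of the rgood tree for
-- the former and `q` for the latter.
half-above : ∀ {b m} → b ≤ suc m → ∃[ i ] i + i + b ≤ suc m × m ≤ i + i + b
half-above {b} {m} b≤ with half (suc m ∸ b)
... | i , lo , hi = i , subst (i + i + b ≤_) (m∸n+n≡m b≤) (+-monoˡ-≤ b lo)
  , ≤-pred (subst (_≤ suc (i + i + b)) (m∸n+n≡m b≤) (+-monoˡ-≤ b hi))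

-- Center and centroid of a crg tree

module CrgTree {n : ℕ} (T : Graph n) (conn : Connected T) (bridges : AllBridges T)
               {p : ℕ} {s t : Shape} (anatomy : Anatomy T p s t) where

  open Tree T conn bridges
  open Centers T conn
  open Branches T conn bridges
  open Hangs T conn bridges
  open Anatomy anatomy

  ca = hang-adj hang-a
  cb = hang-adj hang-b
  ce = hang-adj hang-e

  spineVertex : ∀ {y x k τ} → Hang T y x τ → Comb k τ → ℕ → Fin n
  spineVertex {x = x} _                     _         zero    = x
  -- Past its end the spine stays at its last vertex, so every index denotes a vertex and
  -- consecutive ones are still at distance at most 1.
  spineVertex {x = x} (leaf _ _)            end       (suc i) = x
  spineVertex         (node _ _ _ _ _ h _)  (left r)  (suc i) = spineVertex h r i
  spineVertex         (node _ _ _ _ _ _ h)  (right r) (suc i) = spineVertex h r i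

  spine : ℕ → Fin n
  spine zero    = c
  spine (suc i) = spineVertex hang-e comb i

  dist-edge : ∀ {x y} → Adj T x y → dist x y ≤ 1
  dist-edge {x} {y} e = subst (λ d → dist x y ≤ suc d) (dist-refl y) (dist-adj y e)

  private
    spineVertex-step : ∀ {y x k τ} (h : Hang T y x τ) (r : Comb k τ) i →
                       dist (spineVertex h r (suc i)) (spineVertex h r i) ≤ 1
    spineVertex-step {x = x} (leaf _ _) end zero    = ≤-trans (≤-reflexive (dist-refl x)) z≤n
    spineVertex-step {x = x} (leaf _ _) end (suc i) = ≤-trans (≤-reflexive (dist-refl x)) z≤n
    spineVertex-step (node _ _ _ _ _ h _) (left r)  zero    = dist-edge (adj-sym T (hang-adj h))
    spineVertex-step (node _ _ _ _ _ _ h) (right r) zero    = dist-edge (adj-sym T (hang-adj h))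
    spineVertex-step (node _ _ _ _ _ h _) (left r)  (suc i) = spineVertex-step h r i
    spineVertex-step (node _ _ _ _ _ _ h) (right r) (suc i) = spineVertex-step h r i

  spine-dist : ∀ m j → dist (spine (m + j)) (spine j) ≤ m
  spine-dist zero    j = ≤-reflexive (dist-refl _)
  spine-dist (suc m) j = ≤-trans (triangle _ (spine (m + j)) _) (+-mono-≤ (step (m + j)) (spine-dist m j))
    where
    step : ∀ i → dist (spine (suc i)) (spine i) ≤ 1
    step zero    = dist-edge (adj-sym T ce)
    step (suc i) = spineVertex-step hang-e comb i

  side-c : ∀ u → u ≡ c ⊎ Side c e u ⊎ Side c a u ⊎ Side c b u
  side-c u with u ≟ c
  ... | yes u≡c = inj₁ u≡c
  ... | no  u≢c with towards c u (u≢c ∘ sym)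
  ...   | w , cw , step with nbrs cw
  ...     | inj₁ refl        = inj₂ (inj₁ (≤-reflexive step))
  ...     | inj₂ (inj₁ refl) = inj₂ (inj₂ (inj₁ (≤-reflexive step)))
  ...     | inj₂ (inj₂ refl) = inj₂ (inj₂ (inj₂ (≤-reflexive step)))

  dist-c : ∀ {x τ u} → Hang T c x τ → Side c x u → dist u c ≤ suc (height τ)
  dist-c h su rewrite side-step′ (hang-adj h) su = s≤s (hang-height h su)

  dist-c-tail : ∀ {u} → Side c e u → dist u c ≤ suc p
  dist-c-tail {u} su = subst (λ d → dist u c ≤ suc d) (comb-height comb) (dist-c hang-e su)

  h : ℕ
  h = height (node s t)

  dist-c-rgood : ∀ {u} → ¬ Side c e u → dist u c ≤ h
  dist-c-rgood {u} ¬se with side-c u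
  ... | inj₁ refl             = ≤-trans (≤-reflexive (dist-refl c)) z≤n
  ... | inj₂ (inj₁ se)        = contradiction se ¬se
  ... | inj₂ (inj₂ (inj₁ sa)) = ≤-trans (dist-c hang-a sa) (s≤s (m≤m⊔n _ _))
  ... | inj₂ (inj₂ (inj₂ sb)) = ≤-trans (dist-c hang-b sb) (s≤s (m≤n⊔m (height s) _))

  private
    -- Moving one step along the spine, what is newly left behind is `x` and the leaf beside the
    -- spine; `1 ≤ B` makes room for that leaf.
    child-back : ∀ {B y x w} → Adj T x w →
      (∀ {u} → Side y x u → u ≢ x → ¬ Side x w u → dist u x ≤ 1) → 1 ≤ B →
      (∀ {u} → ¬ Side y x u → dist u x ≤ B) → ∀ {u} → ¬ Side x w u → dist u w ≤ suc B
    child-back {B} {y} {x} {w} xw sibling 1≤B back {u} ¬sw = ≤-trans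
      (subst₂ _≤_ (dist-sym w u) (cong suc (dist-sym x u)) (dist-adj u (adj-sym T xw))) (s≤s bound)
      where
      bound : dist u x ≤ B
      bound with side? y x u | u ≟ x
      ... | no ¬sx | _        = back ¬sx
      ... | yes _  | yes refl = ≤-trans (≤-reflexive (dist-refl x)) z≤n
      ... | yes sx | no u≢x   = ≤-trans (sibling sx u≢x ¬sw) 1≤B

    spineVertex-far : ∀ {B y x k τ} (hx : Hang T y x τ) (r : Comb k τ) → 1 ≤ B →
      (∀ {u} → ¬ Side y x u → dist u x ≤ B) → ∀ i → i ≤ k → ∀ u →
      dist u (spineVertex hx r i) ≤ B + i ⊎ i + dist u (spineVertex hx r i) ≤ k
    spineVertex-far {B} {y} {x} hx r 1≤B back zero _ u with side? y x u
    ... | yes su = inj₂ (subst (dist u x ≤_) (comb-height r) (hang-height hx su))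
    ... | no ¬su = inj₁ (≤-trans (back ¬su) (m≤m+n B 0))
    spineVertex-far {B} (node {y} {x} {a′} {b′} yx _ _ _ nbrs hs ht) (left r) 1≤B back (suc i) (s≤s i≤k) u
      rewrite +-suc B i = Sum.map id s≤s
        (spineVertex-far hs r (s≤s z≤n) (child-back (hang-adj hs) sibling 1≤B back) i i≤k u)
      where
      sibling : ∀ {u} → Side y x u → u ≢ x → ¬ Side x a′ u → dist u x ≤ 1
      sibling su u≢x ¬s with side-cases nbrs su u≢x
      ... | inj₁ sa = contradiction sa ¬s
      ... | inj₂ sb rewrite side-step′ (hang-adj ht) sb = s≤s (hang-height ht sb)
    spineVertex-far {B} (node {y} {x} {a′} {b′} yx _ _ _ nbrs hs ht) (right r) 1≤B back (suc i) (s≤s i≤k) u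
      rewrite +-suc B i = Sum.map id s≤s
        (spineVertex-far ht r (s≤s z≤n) (child-back (hang-adj ht) sibling 1≤B back) i i≤k u)
      where
      sibling : ∀ {u} → Side y x u → u ≢ x → ¬ Side x b′ u → dist u x ≤ 1
      sibling su u≢x ¬s with side-cases nbrs su u≢x
      ... | inj₁ sa rewrite side-step′ (hang-adj hs) sa = s≤s (hang-height hs sa)
      ... | inj₂ sb = contradiction sb ¬s

  -- The first alternative covers the vertices behind position `i`, the farthest of which may lie in
  -- the rgood tree; the second covers those ahead, for which the `p + 1` steps of the spine are the
  -- limit.
  spine-far : ∀ i → i ≤ suc p → ∀ u → dist u (spine i) ≤ h + i ⊎ i + dist u (spine i) ≤ suc p
  spine-far zero _ u with side? c e u
  ... | yes se = inj₂ (dist-c-tail se)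
  ... | no ¬se = inj₁ (≤-trans (dist-c-rgood ¬se) (m≤m+n h 0))
  spine-far (suc i) (s≤s i≤p) u rewrite +-suc h i =
    Sum.map id s≤s (spineVertex-far hang-e comb (s≤s z≤n) back i i≤p u)
    where
    back : ∀ {u} → ¬ Side c e u → dist u e ≤ suc h
    back {u} ¬se = ≤-trans (subst₂ _≤_ (dist-sym e u) (cong suc (dist-sym c u)) (dist-adj u (adj-sym T ce)))
                           (s≤s (dist-c-rgood ¬se))

  deepest : ∀ {x τ} → Hang T c x τ → ∃[ z ] Side c x z × dist z c ≡ suc (height τ)
  deepest {τ = τ} hx =
    let (z , _ , sz , d≡) = hang-leaf hx (leafDepth-height τ)
    in z , sz , trans (side-step′ (hang-adj hx) sz) (cong suc d≡)

  across : ∀ {x z z′} → Adj T c x → Side c x z → Side x c z′ → dist z c + dist c z′ ≤ dist z z′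
  across {x} {z} {z′} cx sz sz′ = subst (_≤ dist z z′)
    (cong (_+ dist c z′) (trans (cong suc (dist-sym x z)) (sym (side-step′ cx sz))))
    (separation cx sz sz′)

  not-side : ∀ {x y z} → Adj T c x → Adj T c y → x ≢ y → Side c x z → Side y c z
  not-side cx cy x≢y sx = side-¬ cy λ sy → x≢y (side-unique cx cy sx sy)

  farthest-rgood : ∃[ z ] Side e c z × dist z c ≡ h
  farthest-rgood with ⊔-sel (height s) (height t)
  ... | inj₁ eq with deepest hang-a
  ...   | z , sz , d≡ = z , not-side ca ce a≢e sz , trans d≡ (cong suc (sym eq))
  farthest-rgood | inj₂ eq with deepest hang-b
  ...   | z , sz , d≡ = z , not-side cb ce b≢e sz , trans d≡ (cong suc (sym eq))

  farthest-tail : ∃[ z ] Side c e z × dist z c ≡ suc p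
  farthest-tail with deepest hang-e
  ... | z , sz , d≡ = z , sz , trans d≡ (cong suc (comb-height comb))

  spine-dist-≤ : ∀ {i E} → i ≤ suc p → h + i ≤ E → suc p ≤ E + i → ∀ u → dist u (spine i) ≤ E
  spine-dist-≤ {i} {E} i≤ near far u with spine-far i i≤ u
  ... | inj₁ d≤ = ≤-trans d≤ near
  ... | inj₂ d≤ = +-cancelˡ-≤ i _ E (≤-trans d≤ (≤-trans far (≤-reflexive (+-comm E i))))

  -- The deepest leaf of the rgood tree and the far end of the caterpillar are at distance
  -- `p + 1 + h`, which serves in `center-criterion`.
  spine-center : ∀ {i E} → i ≤ suc p → h + i ≤ E → suc p ≤ E + i → E + E ≤ suc (suc p + h) →
                 Center T (spine i)
  spine-center i≤ near far short with farthest-tail | farthest-rgood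
  ... | z₁ , s₁ , d₁ | z₂ , s₂ , d₂ = center-criterion z₁ z₂ (spine-dist-≤ i≤ near far)
    (≤-trans short (s≤s (≤-trans (≤-reflexive (cong₂ _+_ (sym d₁) (trans (sym d₂) (dist-sym z₂ c))))
                                 (across ce s₁ s₂))))

  -- The centre lies within E of the end of the caterpillar, which is p + 1 away from c.
  center-dist-rgood : ∀ {i E x y} → i ≤ suc p → h + i ≤ E → suc p ≤ E + i → Center T x →
                      ¬ Side c e y → suc p ≤ E + dist x y
  center-dist-rgood {E = E} {x} {y} i≤ near far cx ¬sy with farthest-tail
  ... | z , sz , d≡ = begin
    suc p                  ≡⟨ sym d≡ ⟩
    dist z c               ≤⟨ m≤m+n _ _ ⟩
    dist z c + dist c y    ≤⟨ across ce sz (side-¬ ce ¬sy) ⟩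
    dist z y               ≤⟨ triangle z x y ⟩
    dist z x + dist x y    ≤⟨ +-monoˡ-≤ (dist x y) (center-dist-≤ (spine-dist-≤ i≤ near far) cx z) ⟩
    E + dist x y           ∎
    where open ≤-Reasoning

  private
    -- For a short caterpillar the long path has its ends at deepest leaves of the two subtrees; the
    -- hypothesis says that their heights differ by at most one.
    long-rgood : h + h ≤ suc (suc (height s) + suc (height t)) →
                 ∃[ z₁ ] ∃[ z₂ ] h + h ≤ suc (dist z₁ z₂)
    long-rgood flat with deepest hang-a | deepest hang-b
    ... | z₁ , s₁ , d₁ | z₂ , s₂ , d₂ = z₁ , z₂ , ≤-trans flat
          (s≤s (≤-trans (≤-reflexive (cong₂ _+_ (sym d₁) (trans (sym d₂) (dist-sym z₂ c))))
                        (across ca s₁ (not-side cb ca (a≢b ∘ sym) s₂))))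

  hub-center : suc p ≤ h → h + h ≤ suc (suc (height s) + suc (height t)) → Center T c
  hub-center short flat with long-rgood flat
  ... | z₁ , z₂ , long = center-criterion z₁ z₂
          (spine-dist-≤ {0} {h} z≤n (≤-reflexive (+-identityʳ h)) (≤-trans short (m≤m+n h 0))) long

  -- With subtrees of different heights and a short caterpillar the longest path has odd length, and
  -- `a` is its second middle vertex.
  child-center : suc p < h → height t < height s → h + h ≤ suc (suc (height s) + suc (height t)) →
                 Center T a
  child-center short lower flat with long-rgood flat
  ... | z₁ , z₂ , long = center-criterion z₁ z₂ bound long
    where
    h≡ : h ≡ suc (height s)
    h≡ = cong suc (m≥n⇒m⊔n≡m (<⇒≤ lower))
    dist-c-≤ : ∀ {u} → ¬ Side c a u → dist u c ≤ height s
    dist-c-≤ {u} ¬sa with side-c u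
    ... | inj₁ refl             = ≤-trans (≤-reflexive (dist-refl c)) z≤n
    ... | inj₂ (inj₁ se)        = ≤-trans (dist-c-tail se) (≤-pred (subst (suc (suc p) ≤_) h≡ short))
    ... | inj₂ (inj₂ (inj₁ sa)) = contradiction sa ¬sa
    ... | inj₂ (inj₂ (inj₂ sb)) = ≤-trans (dist-c hang-b sb) lower
    bound : ∀ u → dist u a ≤ h
    bound u with side? c a u
    ... | yes sa = subst (dist u a ≤_) (sym h≡) (≤-trans (hang-height hang-a sa) (n≤1+n _))
    ... | no ¬sa = subst (dist u a ≤_) (sym h≡) (≤-trans
          (subst₂ _≤_ (dist-sym a u) (cong suc (dist-sym c u)) (dist-adj u (adj-sym T ca)))
          (s≤s (dist-c-≤ ¬sa)))

  private
    light-back : ∀ {y x} → Adj T y x → n ≤ size y x + size y x → size x y + size x y ≤ n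
    light-back {y} {x} yx heavy = begin
      size x y + size x y   ≤⟨ +-monoˡ-≤ (size x y) (+-cancelˡ-≤ (size y x) _ _
                                 (≤-trans (≤-reflexive (size-complement yx)) heavy)) ⟩
      size y x + size x y   ≡⟨ size-complement yx ⟩
      n                     ∎
      where open ≤-Reasoning

    heavy-size : ∀ {y x τ} → Hang T y x τ → n ≤ order τ + order τ → n ≤ size y x + size y x
    heavy-size hx = subst (λ k → n ≤ k + k) (sym (hang-size hx))

    light-size : ∀ {y x τ} → Hang T y x τ → order τ + order τ ≤ n → size y x + size y x ≤ n
    light-size hx = subst (λ k → k + k ≤ n) (sym (hang-size hx))

  hang-node-light : ∀ {y x σ τ} → Hang T y x (node σ τ) → n ≤ order (node σ τ) + order (node σ τ) →
                    order σ + order σ ≤ n → order τ + order τ ≤ n → Light x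
  hang-node-light hx@(node yx _ _ _ nbrs hs ht) heavy light-s light-t xw with nbrs xw
  ... | inj₁ refl        = light-back yx (heavy-size hx heavy)
  ... | inj₂ (inj₁ refl) = light-size hs light-s
  ... | inj₂ (inj₂ refl) = light-size ht light-t

  -- The continuing child of a comb has order `2k - 1`. The last inequality says that twice this is
  -- at most `n`, with the 2 moved across to avoid subtraction; the one before it makes the branch
  -- towards `y` light.
  hang-comb-light : ∀ {y x k τ} → 2 ≤ n → Hang T y x τ → Comb k τ → n ≤ suc (k + k) + suc (k + k) →
                    (k + k) + (k + k) ≤ n + 2 → Light x
  hang-comb-light _ hx@(leaf yx only) end heavy _ xw with refl ← only xw =
    light-back yx (heavy-size hx heavy)
  hang-comb-light 2≤n hx (left {k} r) heavy light = hang-node-light hx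
    (subst (λ m → n ≤ m + m) (sym (comb-order (left r))) heavy)
    (subst (λ m → m + m ≤ n) (sym (comb-order r)) (comb-light k n light)) 2≤n
  hang-comb-light 2≤n hx (right {k} r) heavy light = hang-node-light hx
    (subst (λ m → n ≤ m + m) (sym (comb-order (right r))) heavy) 2≤n
    (subst (λ m → m + m ≤ n) (sym (comb-order r)) (comb-light k n light))

-- Upper bounds on the distance d between centre and centroid, according to where
-- these lie: B is the order of the smaller subtree of the rgood tree's root when
-- the centroid is the root of the other one.
data DistanceBound (p q k d : ℕ) : Set where
  coincide    : d ≡ 0 → DistanceBound p q k d
  on-tail     : ∀ i j → q ≤ p → i + i + suc k ≤ suc p → suc p ≤ j + j + q → 1 ≤ j → d + j ≤ i →
                DistanceBound p q k d
  at-root     : p < q → d + d + suc k ≤ suc p → DistanceBound p q k d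
  below-root  : ∀ B → d + d + suc k ≤ suc (suc (suc p)) → suc (suc p) + B ≤ q → 2 ^ k ≤ suc B →
                DistanceBound p q k d
  inside      : ∀ A B → d ≤ 1 → suc (suc p) + B ≤ q → 2 ^ k < B → A + B ≡ q + q → suc A ≤ 2 ^ suc k →
                DistanceBound p q k d

module CrgDistance {n : ℕ} {T : Graph n} (conn : Connected T) (bridges : AllBridges T)
                   {p q : ℕ} {s t : Shape} (anatomy : Anatomy T p s t)
                   (orders : order s + order t ≡ q + q) (n≡ : n ≡ suc (p + q) + suc (p + q))
                   (balanced : Balanced (node s t)) where

  open Tree T conn bridges
  open Branches T conn bridges
  open Hangs T conn bridges
  open CrgTree T conn bridges anatomy
  open Anatomy anatomy

  κ : ℕ
  κ = height s ⊔ height t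

  deep : Deep κ (node s t)
  deep = balanced-deep balanced

  κ<q : κ < q
  κ<q = ≤-trans (n<2^n κ) (proj₁ (balanced-range balanced orders))

  2≤n : 2 ≤ n
  2≤n = subst (2 ≤_) (sym n≡) (s≤s (≤-trans (s≤s z≤n) (m≤n+m _ (p + q))))

  -- The window leaves room for both centers when `p + 1 - h` is odd. This freedom is needed where
  -- the centroid would otherwise lie one step beyond the chosen center.
  spine-center′ : ∀ {i} → p ≤ i + i + suc κ → i + i + suc κ ≤ suc (suc p) → Center T (spine i)
  spine-center′ {i} lo hi with suc p ≤? suc κ + i + i
  -- The radius is `h + i` if this reaches the end of the caterpillar, and one more otherwise.
  ... | yes far = spine-center (center-index p κ i hi) ≤-refl far (center-short₁ p (suc κ) i hi)
  ... | no ¬far = spine-center (center-index p κ i hi) (n≤1+n _) (center-far p (suc κ) i lo)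
                    (center-short₂ p (suc κ) i (≤-pred (≰⇒> ¬far)))

  private
    spineVertex-hang : ∀ {y x K τ} (hx : Hang T y x τ) (r : Comb K τ) i m → m + i ≡ K →
                       ∃[ y′ ] ∃[ τ′ ] Hang T y′ (spineVertex hx r i) τ′ × Comb m τ′
    spineVertex-hang hx r zero m eq with refl ← trans (sym (+-identityʳ m)) eq = _ , _ , hx , r
    spineVertex-hang (leaf _ _) end (suc i) m eq = contradiction (trans (sym (+-suc m i)) eq) λ ()
    spineVertex-hang (node _ _ _ _ _ hx _) (left r) (suc i) m eq =
      spineVertex-hang hx r i m (suc-injective (trans (sym (+-suc m i)) eq))
    spineVertex-hang (node _ _ _ _ _ _ hx) (right r) (suc i) m eq =
      spineVertex-hang hx r i m (suc-injective (trans (sym (+-suc m i)) eq))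

  -- The lower end of the window makes the branch ahead light, the upper end the branch back towards
  -- `c`.
  spine-centroid : ∀ {i} → p ≤ suc i + suc i + q → suc i + suc i + q ≤ suc (suc p) → Centroid T (spine (suc i))
  spine-centroid {i} lo hi with spineVertex-hang hang-e comb i (p ∸ i) (m∸n+n≡m i≤p)
    where i≤p = spine-index p i q hi
  ... | y , τ , hx , r = centroid-criterion (y , adj-sym T (hang-adj hx))
    (hang-comb-light 2≤n hx r
      (subst (_≤ suc (m + m) + suc (m + m)) (sym n≡′)
        (spine-heavy m i q (subst (λ p → suc i + suc i + q ≤ suc (suc p)) p≡ hi)))
      (subst (λ N → (m + m) + (m + m) ≤ N + 2) (sym n≡′)
        (spine-child-light m i q (subst (_≤ suc i + suc i + q) p≡ lo))))
    where
    m = p ∸ i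
    p≡ : p ≡ m + i
    p≡ = sym (m∸n+n≡m (spine-index p i q hi))
    n≡′ : n ≡ suc (m + i + q) + suc (m + i + q)
    n≡′ = trans n≡ (cong (λ p → suc (p + q) + suc (p + q)) p≡)

  private
    light-order : ∀ {A} → A ≤ suc (p + q) → A + A ≤ n
    light-order A≤ = subst (_ ≤_) (sym n≡) (+-mono-≤ A≤ A≤)

  hub-light : p ≤ q → order s ≤ suc (p + q) → order t ≤ suc (p + q) → Light c
  hub-light p≤q s≤ t≤ cw with nbrs cw
  ... | inj₁ refl = subst₂ (λ m N → m + m ≤ N)
          (sym (trans (hang-size hang-e) (comb-order comb))) (sym n≡) (tail-light p q p≤q)
  ... | inj₂ (inj₁ refl) = subst (λ m → m + m ≤ n) (sym (hang-size hang-a)) (light-order s≤)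
  ... | inj₂ (inj₂ refl) = subst (λ m → m + m ≤ n) (sym (hang-size hang-b)) (light-order t≤)

  hub-centroid : p ≤ q → order s ≤ suc (p + q) → order t ≤ suc (p + q) → Centroid T c
  hub-centroid p≤q s≤ t≤ = centroid-criterion (e , ce) (hub-light p≤q s≤ t≤)

  -- The root of the larger subtree s is a centroid, since its subtrees are shallower
  -- than t is deep.
  child-centroid : suc (p + q) < order s → Centroid T a × ∃[ κ′ ] κ ≡ suc κ′
  child-centroid heavy = go hang-a refl
    where
    go : ∀ {σ} → Hang T c a σ → s ≡ σ → Centroid T a × ∃[ κ′ ] κ ≡ suc κ′
    go (leaf _ _) refl = contradiction heavy λ { (s≤s ()) }
    go ha@(node {s = s₁} {s₂} _ _ _ _ _ _ _) refl =
      centroid-criterion (c , adj-sym T ca) (hang-node-light ha heavy′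
        (light-child (≤-pred (≤-trans (s≤s (m≤m⊔n (height s₁) (height s₂)))
          (≤-trans (m≤m⊔n (height s) (height t)) (≤-reflexive κ≡)))))
        (light-child (≤-pred (≤-trans (s≤s (m≤n⊔m (height s₁) (height s₂)))
          (≤-trans (m≤m⊔n (height s) (height t)) (≤-reflexive κ≡))))))
      , κ′ , κ≡
      where
      κ′ = (height s₁ ⊔ height s₂) ⊔ (height t ∸ 1)
      κ≡ : κ ≡ suc κ′
      κ≡ with height t
      ... | zero  = cong suc (sym (⊔-identityʳ _))
      ... | suc _ = refl
      heavy′ : n ≤ order s + order s
      heavy′ = subst (_≤ order s + order s) (sym n≡) (+-mono-≤ (<⇒≤ heavy) (<⇒≤ heavy))
      light-child : ∀ {σ} → height σ ≤ κ′ → order σ + order σ ≤ n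
      light-child {σ} low = light-order (≤-trans
        (≤-pred (≤-trans (order-≤ κ′ σ low)
          (order-≥ κ′ t (deep-right (subst (λ m → Deep m (node s t)) κ≡ deep)))))
        (sibling-light p q (order s) (order t) orders heavy))

  private
    -- By balance even the lower subtree has its leaves at depth at least `κ` below `c`.
    flat : suc κ + suc κ ≤ suc (suc (height s) + suc (height t))
    flat with ⊔-sel (height s) (height t)
    ... | inj₁ eq = ≤-trans (+-mono-≤ (s≤s (≤-reflexive eq)) (s≤s (deep (right (leafDepth-height t)))))
                            (≤-reflexive (+-suc (suc (height s)) (suc (height t))))
    ... | inj₂ eq = +-mono-≤ (s≤s (deep (left (leafDepth-height s)))) (s≤s (≤-reflexive eq))

  module _ {d : ℕ} (d≤ : ∀ {x y} → Center T x → Centroid T y → d ≤ dist x y) where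

    -- The centroid `a` is one step beyond `c`, which costs one unit when the center is on the
    -- spine. If the caterpillar is short, either `a` is a center as well, or `t` is as high as the
    -- whole allows; in the latter case `c` is a center and `t` is large.
    bound-heavy-child : suc (p + q) < order s → DistanceBound p q κ d
    bound-heavy-child heavy with child-centroid heavy | suc κ ≤? suc p
    ... | centroid , κ′ , κ≡ | yes h≤ with half-above h≤
    ...   | i , hi , lo = below-root (order t)
              (double-suc d i (suc κ) (suc p) (≤-trans (d≤ (spine-center′ {i} lo (m≤n⇒m≤1+n hi)) centroid)
                (≤-trans (triangle (spine i) c a)
                  (≤-trans (+-mono-≤ spine-c (dist-edge ca)) (≤-reflexive (+-comm i 1))))) hi)
              (sibling-small p q (order s) (order t) orders heavy)
              (subst (λ m → 2 ^ m ≤ suc (order t)) (sym κ≡)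
                (order-≥ κ′ t (deep-right (subst (λ m → Deep m (node s t)) κ≡ deep))))
      where
      spine-c : dist (spine i) c ≤ i
      spine-c = subst (λ j → dist (spine j) c ≤ i) (+-identityʳ i) (spine-dist i 0)
    bound-heavy-child heavy | centroid , κ′ , κ≡ | no h≰ with height t <? height s
    ... | yes lower = coincide (n≤0⇒n≡0 (≤-trans (d≤ (child-center (≰⇒> h≰) lower flat) centroid)
                                                 (≤-reflexive (dist-refl a))))
    ... | no ¬lower = inside (order s) (order t)
              (≤-trans (d≤ (hub-center (<⇒≤ (≰⇒> h≰)) flat) centroid) (dist-edge ca))
              (sibling-small p q (order s) (order t) orders heavy)
              (subst (λ m → 2 ^ m < order t) (sym κ≡)
                (order-> κ′ t (deep-right (subst (λ m → Deep m (node s t)) κ≡ deep))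
                  (≤-reflexive (trans (sym κ≡) (m≤n⇒m⊔n≡n (≮⇒≥ ¬lower))))))
              orders (order-≤ κ s (m≤m⊔n (height s) (height t)))

    bound-light-children : p < q → order s ≤ suc (p + q) → order t ≤ suc (p + q) → DistanceBound p q κ d
    bound-light-children p<q s≤ t≤ with suc κ ≤? suc p
    ... | yes h≤ with half-above h≤
    ...   | i , hi , lo = at-root p<q (double-+ d i (suc κ) (suc p)
              (≤-trans (d≤ (spine-center′ {i} lo (m≤n⇒m≤1+n hi)) (hub-centroid (<⇒≤ p<q) s≤ t≤))
                (subst (λ j → dist (spine j) c ≤ i) (+-identityʳ i) (spine-dist i 0))) hi)
    bound-light-children p<q s≤ t≤ | no h≰ = coincide (n≤0⇒n≡0 (≤-trans
      (d≤ (hub-center (<⇒≤ (≰⇒> h≰)) flat) (hub-centroid (<⇒≤ p<q) s≤ t≤)) (≤-reflexive (dist-refl c))))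

    bound-on-tail : q ≤ p → DistanceBound p q κ d
    bound-on-tail q≤p with half-above {q} {suc p} (m≤n⇒m≤1+n (m≤n⇒m≤1+n q≤p))
    ... | zero , _ , lo = contradiction (≤-trans lo q≤p) (<⇒≱ ≤-refl)
    ... | j@(suc j′) , hi , lo with half-above {suc κ} {p} (≤-trans κ<q (m≤n⇒m≤1+n q≤p))
    ...   | i , hi′ , lo′ with j ≤? i
    ...     | yes j≤i = on-tail i j q≤p hi′ lo (s≤s z≤n)
                (subst (d + j ≤_) (m∸n+n≡m j≤i) (+-monoˡ-≤ j
                  (≤-trans (d≤ (spine-center′ {i} lo′ (m≤n⇒m≤1+n hi′)) (spine-centroid {j′} (<⇒≤ lo) hi))
                    (subst (λ i′ → dist (spine i′) (spine j) ≤ i ∸ j) (m∸n+n≡m j≤i) (spine-dist (i ∸ j) j)))))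
    -- Since `κ < q`, position `j` still lies in the window of `spine-center′`, so it is both center
    -- and centroid.
    ...     | no j≰i = coincide (n≤0⇒n≡0 (≤-trans
                (d≤ (spine-center′ {j} (≤-trans lo′ (+-monoˡ-≤ (suc κ) (+-mono-≤ i≤j i≤j)))
                                   (≤-trans (+-monoʳ-≤ (j + j) κ<q) hi))
                    (spine-centroid {j′} (<⇒≤ lo) hi))
                (≤-reflexive (dist-refl (spine j)))))
      where i≤j = <⇒≤ (≰⇒> j≰i)

  -- Here `c` is light, so every centroid is light and lies outside the caterpillar proper. Every
  -- center is within the radius of the far end of the caterpillar, hence at least `i` away from all
  -- vertices outside.
  distance-lower : p < q → q ≤ suc (suc p) → ∀ {x y} → Center T x → Centroid T y →
                   p ≤ dist x y + dist x y + suc κ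
  distance-lower p<q q≤ {x} {y} cx cy with suc κ ≤? suc p
  ... | no h≰ = ≤-trans (≤-pred (<⇒≤ (≰⇒> h≰))) (≤-trans (n≤1+n κ) (m≤n+m (suc κ) _))
  ... | yes h≤ with half-above h≤
  ...   | i , hi , lo = ≤-trans lo (+-monoˡ-≤ (suc κ) (+-mono-≤ i≤d i≤d))
    where
    i≤p : i ≤ suc p
    i≤p = center-index p κ i (m≤n⇒m≤1+n hi)
    -- The distance from position `i` to the end of the caterpillar bounds the radius, so the
    -- triangle inequality leaves exactly `i`.
    E = suc p ∸ i
    near : suc κ + i ≤ E
    near = +-cancelʳ-≤ i (suc κ + i) E (≤-trans
      (≤-trans (≤-reflexive rearrange) hi) (≤-reflexive (sym (m∸n+n≡m i≤p))))
      where
      rearrange : suc κ + i + i ≡ i + i + suc κ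
      rearrange = trans (+-assoc (suc κ) i i) (+-comm (suc κ) (i + i))
    off-caterpillar : ¬ Side c e y
    off-caterpillar sy with towards y c (side⇒≢ sy)
    ... | w , yw , step = contradiction (a+a≤1+b+b⇒a≤b (off-tail p q (size y w) big small)) (<⇒≱ p<q)
      where
      size-e : size c e ≡ suc (p + p)
      size-e = trans (hang-size hang-e) (comb-order comb)
      big : suc (p + q) + suc (p + q) ≤ size y w + suc (p + p)
      big = subst₂ (λ N m → N ≤ size y w + m) n≡ size-e (size-opposite ce yw sy (≤-reflexive step))
      small : size y w + size y w ≤ suc (p + q) + suc (p + q)
      small = subst (size y w + size y w ≤_) n≡ (centroid-light (e , ce)
        (hub-light (<⇒≤ p<q)
          (child-light p q (order s) (order t) orders (order-positive t) q≤)
          (child-light p q (order t) (order s) (trans (+-comm (order t) (order s)) orders)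
            (order-positive s) q≤))
        cy yw)
    i≤d : i ≤ dist x y
    i≤d = +-cancelˡ-≤ E i (dist x y) (≤-trans (≤-reflexive (m∸n+n≡m i≤p))
      (center-dist-rgood i≤p near (≤-reflexive (sym (m∸n+n≡m i≤p))) cx off-caterpillar))

-- Comparison with the optimal tree

2^-reflects-< : ∀ {a b x} → 2 ^ a ≤ x → x < 2 ^ b → a < b
2^-reflects-< {a} {b} lo hi with ≤-<-connex b a
... | inj₁ b≤a = contradiction (≤-trans (^-monoʳ-≤ 2 b≤a) lo) (<⇒≱ hi)
... | inj₂ a<b = a<b

-- The first doubling makes room for two units and each further one for at least one, so raising `q`
-- by `m + 2` costs only `m + 1` doublings.
2^-grows : ∀ {q k} m → q < 2 ^ suc k → suc (suc (m + q)) < 2 ^ suc (suc (m + k))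
2^-grows {q} {k} zero q< = begin-strict
  suc (suc q)             ≡⟨ +-comm 1 (suc q) ⟩
  suc q + 1               <⟨ +-mono-≤-< q< (*-monoʳ-≤ 2 (m^n>0 2 k)) ⟩
  2 ^ suc k + 2 ^ suc k   ≡⟨ sym (2^-suc (suc k)) ⟩
  2 ^ suc (suc k)         ∎
  where open ≤-Reasoning
2^-grows {q} {k} (suc m) q< = begin-strict
  suc (suc (suc (m + q)))                       ≡⟨ +-comm 1 (suc (suc (m + q))) ⟩
  suc (suc (m + q)) + 1                         <⟨ +-mono-<-≤ (2^-grows m q<) (m^n>0 2 (suc (suc (m + k)))) ⟩
  2 ^ suc (suc (m + k)) + 2 ^ suc (suc (m + k)) ≡⟨ sym (2^-suc (suc (suc (m + k)))) ⟩
  2 ^ suc (suc (suc (m + k)))                   ∎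
  where open ≤-Reasoning

2k+2≤2^k : ∀ k → 6 ≤ 2 ^ k → suc k + suc k ≤ 2 ^ k
2k+2≤2^k zero (s≤s ())
2k+2≤2^k (suc zero) (s≤s (s≤s ()))
2k+2≤2^k (suc (suc zero)) (s≤s (s≤s (s≤s (s≤s ()))))
2k+2≤2^k (suc (suc (suc zero))) _ = ≤-refl
2k+2≤2^k (suc k@(suc (suc (suc j)))) _ = begin
  suc (suc k) + suc (suc k)   ≡⟨ rearrange k ⟩
  suc k + suc k + 2           ≤⟨ +-mono-≤ (2k+2≤2^k k (≤-trans (m≤m+n 6 2)
                                             (^-monoʳ-≤ 2 {3} {k} (s≤s (s≤s (s≤s z≤n))))))
                                          (^-monoʳ-≤ 2 {1} {k} (s≤s z≤n)) ⟩
  2 ^ k + 2 ^ k               ≡⟨ sym (2^-suc k) ⟩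
  2 ^ suc k                   ∎
  where
  open ≤-Reasoning
  rearrange : ∀ k → suc (suc k) + suc (suc k) ≡ suc k + suc k + 2
  rearrange k = solve (k List.∷ List.[])

module Comparison {p q p* q* : ℕ} (total : p + q ≡ p* + q*) (p*<q* : p* < q*) (q*≤ : q* ≤ suc (suc p*)) where

  -- For the given sum, `q*` is the least value exceeding its partner.
  optimal-≤ : p < q → q* ≤ q
  optimal-≤ p<q with ≤-<-connex q* q
  ... | inj₁ le = le
  ... | inj₂ lt = contradiction
          (linear {1} {0} 0 (+-mono-≤ (+-mono-≤ (+-mono-≤ p<q lt) (+-mono-≤ lt (≤-reflexive (sym total)))) q*≤)
            (solve (p List.∷ q List.∷ p* List.∷ q* List.∷ List.[]))) λ ()

  optimal-> : q ≤ p → q < q*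
  optimal-> q≤p with ≤-<-connex q* q
  ... | inj₂ lt = lt
  ... | inj₁ le = contradiction
          (linear {1} {0} 0 (+-mono-≤ (+-mono-≤ (+-mono-≤ q≤p p*<q*) (+-mono-≤ le le)) (≤-reflexive total))
            (solve (p List.∷ q List.∷ p* List.∷ q* List.∷ List.[]))) λ ()

  optimal-p : q* ≤ q → p ≤ p*
  optimal-p le = linear 0 (+-mono-≤ le (≤-reflexive total))
    (solve (p List.∷ q List.∷ p* List.∷ q* List.∷ List.[]))

  -- When the larger subtree is heavy, the split is so uneven that `p` falls short of `p*` by at
  -- least `B / 2`; this gap pays for the displaced centroid.
  sibling-p* : ∀ {B} → suc (suc p) + B ≤ q → p + p + B ≤ p* + p*
  sibling-p* {B} le = linear 0 (+-mono-≤ (+-mono-≤ le (≤-reflexive total)) q*≤)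
    (solve (p List.∷ q List.∷ p* List.∷ q* List.∷ B List.∷ List.[]))

-- Rules out a heavy subtree when the height is at most 2. The comparison of distances uses `n ≥ 12`
-- here, as `5 ≤ p + q`. The absurd conclusion is in the form that `linear` delivers.
few-vertices : ∀ p q B → suc (suc p) + B ≤ q → q < 4 → 5 ≤ p + q → 1 ≤ 0
few-vertices p q B le q<4 5≤ = linear B (+-mono-≤ (+-mono-≤ le q<4) (+-mono-≤ q<4 5≤))
  (solve (p List.∷ q List.∷ B List.∷ List.[]))

-- With `W = 2 ^ k`, heaviness gives `A ≥ 2p + 4 + B`, so `2W ≥ A + 1 ≥ 2p + W + 6`.
wide-sibling : ∀ p q A B W → suc (suc p) + B ≤ q → W < B → A + B ≡ q + q → suc A ≤ W + W → 6 ≤ W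
wide-sibling p q A B W small deep orders shallow =
  linear (p + p) (+-mono-≤ (+-mono-≤ (+-mono-≤ small small) deep) (+-mono-≤ (≤-reflexive (sym orders)) shallow))
    (solve (p List.∷ q List.∷ A List.∷ B List.∷ W List.∷ List.[]))

tail-step : ∀ d i j k p → d + j ≤ i → i + i + suc k ≤ suc p → 1 ≤ j → d + d + suc (suc k) ≤ p
tail-step d i j k p d≤ i≤ 1≤j = linear 0 (+-mono-≤ (+-mono-≤ (+-mono-≤ d≤ d≤) i≤) (+-mono-≤ 1≤j 1≤j))
  (solve (d List.∷ i List.∷ j List.∷ k List.∷ p List.∷ List.[]))

tail-gap : ∀ d i j k p q → d + j ≤ i → i + i + suc k ≤ suc p → suc p ≤ j + j + q → d + d + suc k ≤ q
tail-gap d i j k p q d≤ i≤ j≥ = linear 0 (+-mono-≤ (+-mono-≤ (+-mono-≤ d≤ d≤) i≤) j≥)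
  (solve (d List.∷ i List.∷ j List.∷ k List.∷ p List.∷ q List.∷ List.[]))

-- For `q* = q + 1` the estimate by `tail-gap` misses the goal by one, so `tail-step` is used, which
-- gains a unit from `1 ≤ j`. For larger `q*` the unit comes from `2^-grows`, since the height then
-- grows more slowly than `q`.
tail-optimal : ∀ {i j d p q k p* q* k*} m → q* ≡ suc (m + q) → q < 2 ^ suc k → p + q ≡ p* + q* →
  q* ≤ suc (suc p*) → 2 ^ k* ≤ q* → i + i + suc k ≤ suc p → suc p ≤ j + j + q → 1 ≤ j → d + j ≤ i →
  d + d + suc k* ≤ suc p*
tail-optimal {i} {j} {d} {p} {q} {k} {p*} {k* = k*} zero refl q< total q*≤ k*≤ i≤ j≥ 1≤j d≤ = begin
  d + d + suc k*        ≤⟨ +-monoʳ-≤ (d + d) (2^-reflects-< k*≤ 2^k*<) ⟩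
  d + d + suc (suc k)   ≤⟨ tail-step d i j k p d≤ i≤ 1≤j ⟩
  p                     ≡⟨ +-cancelʳ-≡ q p (suc p*) (trans total (+-suc p* q)) ⟩
  suc p*                ∎
  where
  open ≤-Reasoning
  2^k*< : suc q < 2 ^ suc (suc k)
  2^k*< = ≤-trans (n≤1+n _) (2^-grows {q} {k} zero q<)
tail-optimal {i} {j} {d} {p} {q} {k} {p*} {k* = k*} (suc m) refl q< total q*≤ k*≤ i≤ j≥ 1≤j d≤ =
  add d m k p* q k* (≤-pred (2^-reflects-< k*≤ (2^-grows m q<))) (tail-gap d i j k p q d≤ i≤ j≥) q*≤
  where
  add : ∀ d m k p* q k* → k* ≤ suc (m + k) → d + d + suc k ≤ q → suc (suc (m + q)) ≤ suc (suc p*) →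
        d + d + suc k* ≤ suc p*
  add d m k p* q k* h₁ h₂ h₃ = linear 0 (+-mono-≤ (+-mono-≤ h₁ h₂) h₃)
    (solve (d List.∷ m List.∷ k List.∷ p* List.∷ q List.∷ k* List.∷ List.[]))

distance-optimal : ∀ {p q k d p* q* k* d*} → DistanceBound p q k d → q < 2 ^ suc k →
  p + q ≡ p* + q* → p* < q* → q* ≤ suc (suc p*) → 5 ≤ p + q → 2 ^ k* ≤ q* →
  p* ≤ d* + d* + suc k* → d ≤ d*
distance-optimal {p} {q} {k} {d} {p*} {q*} {k*} {d*} bound q< total p*<q* q*≤ 5≤ k*≤ lower = go bound
  where
  open Comparison {p} {q} total p*<q* q*≤

  conclude : d + d + suc k* ≤ suc p* → d ≤ d*
  conclude le = a+a≤1+b+b⇒a≤b (+-cancelʳ-≤ (suc k*) (d + d) (suc (d* + d*)) (≤-trans le (s≤s lower)))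

  k*≤k : q* ≤ q → k* ≤ k
  k*≤k le = ≤-pred (2^-reflects-< k*≤ (≤-trans (s≤s le) q<))

  -- For `q* ≤ q` the optimal tree has the smaller rgood part, so its height may be replaced by that
  -- of the given tree.
  compare : ∀ {m} → q* ≤ q → d + d + suc k ≤ m → m ≤ suc p* → d ≤ d*
  compare le d≤ m≤ = conclude (≤-trans (+-monoʳ-≤ (d + d) (s≤s (k*≤k le))) (≤-trans d≤ m≤))

  p<q : ∀ {B} → suc (suc p) + B ≤ q → p < q
  p<q small = ≤-trans (n≤1+n _) (≤-trans (m≤m+n (suc (suc p)) _) small)

  go : DistanceBound p q k d → d ≤ d*
  go (coincide refl) = z≤n
  go (at-root p<q d≤) = compare (optimal-≤ p<q) d≤ (s≤s (optimal-p (optimal-≤ p<q)))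
  go (below-root B d≤ small deep) with 2 ≤? k
  ... | no ¬2≤k = contradiction (few-vertices p q B small
          (≤-trans q< (^-monoʳ-≤ 2 (≰⇒> ¬2≤k))) 5≤) λ ()
  -- The bound on `d` has `p + 3` in place of `p* + 1`, so `p + 2 ≤ p*` is wanted. It follows from
  -- `B ≥ 3` by parity.
  ... | yes 2≤k = compare (optimal-≤ (p<q small)) d≤ (s≤s (a+a≤1+b+b⇒a≤b (begin
          suc (suc p) + suc (suc p)   ≡⟨ rearrange p ⟩
          suc (p + p + 3)             ≤⟨ s≤s (+-monoʳ-≤ (p + p) (≤-pred (≤-trans (^-monoʳ-≤ 2 2≤k) deep))) ⟩
          suc (p + p + B)             ≤⟨ s≤s (sibling-p* small) ⟩
          suc (p* + p*)               ∎)))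
    where
    open ≤-Reasoning
    rearrange : ∀ p → suc (suc p) + suc (suc p) ≡ suc (p + p + 3)
    rearrange p = solve (p List.∷ List.[])
  -- With `d ≤ 1` the goal becomes `k + 2 ≤ p*`. The size of `B`, more than `2 ^ k`, yields it once
  -- `k` is at least 3.
  go (inside A B d≤1 small deep orders shallow) = compare (optimal-≤ (p<q small))
    (+-monoˡ-≤ (suc k) (+-mono-≤ d≤1 d≤1)) (s≤s (a+a≤1+b+b⇒a≤b (begin
      suc (suc k) + suc (suc k)   ≡⟨ cong suc (+-suc (suc k) (suc k)) ⟩
      suc (suc (suc k + suc k))   ≤⟨ s≤s (s≤s (2k+2≤2^k k (wide-sibling p q A B (2 ^ k) small deep orders
                                       (≤-trans shallow (≤-reflexive (2^-suc k)))))) ⟩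
      suc (suc (2 ^ k))           ≤⟨ s≤s deep ⟩
      suc B                       ≤⟨ s≤s (m≤n+m B (p + p)) ⟩
      suc (p + p + B)             ≤⟨ s≤s (sibling-p* small) ⟩
      suc (p* + p*)               ∎)))
    where open ≤-Reasoning
  go (on-tail i j q≤p i≤ j≥ 1≤j d≤) with m≤n⇒∃[o]m+o≡n (optimal-> q≤p)
  ... | m , q*≡ = conclude (tail-optimal {i = i} {j} m (trans (sym q*≡) (cong suc (+-comm q m)))
          q< total q*≤ k*≤ i≤ j≥ 1≤j d≤)

-- Bounds for a given crg tree

module _ {n : ℕ} {T : Graph n} (conn : Connected T) (bridges : AllBridges T)
         {p q : ℕ} {s t : Shape} (anatomy : Anatomy T p s t)
         (orders : order s + order t ≡ q + q) (n≡ : n ≡ suc (p + q) + suc (p + q))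
         (balanced : Balanced (node s t)) where

  private
    swapped : Anatomy T p t s
    swapped = record
      { comb = comb ; hang-a = hang-b ; hang-b = hang-a ; hang-e = hang-e
      ; a≢b = a≢b ∘ sym ; a≢e = b≢e ; b≢e = a≢e ; nbrs = Sum.map id Sum.swap ∘ nbrs }
      where open Anatomy anatomy

    swap-depth : ∀ {s t j} → LeafDepth (node t s) j → LeafDepth (node s t) j
    swap-depth (left d)  = right d
    swap-depth (right d) = left d

    module D = CrgDistance conn bridges {q = q} anatomy orders n≡ balanced
    module D′ = CrgDistance conn bridges {q = q} swapped
      (trans (+-comm (order t) (order s)) orders) n≡ (λ d d′ → balanced (swap-depth d) (swap-depth d′))

  distance-bound : ∀ {d} → IsCenterCentroidDistance T d → DistanceBound p q (height s ⊔ height t) d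
  distance-bound {d} (_ , minimal) = by-cases
    where
    open Metric T conn
    d≤ : ∀ {x y} → Center T x → Centroid T y → d ≤ dist x y
    d≤ {x} {y} cx cy = minimal _ (x , y , cx , cy , isDistance x y)
    by-cases : DistanceBound p q (height s ⊔ height t) d
    by-cases with q ≤? p | order s ≤? suc (p + q) | order t ≤? suc (p + q)
    ... | yes q≤p | _      | _      = D.bound-on-tail d≤ q≤p
    ... | no  q≰p | yes s≤ | yes t≤ = D.bound-light-children d≤ (≰⇒> q≰p) s≤ t≤
    ... | no  _   | no s≰  | _      = D.bound-heavy-child d≤ (≰⇒> s≰)
    -- The two subtrees of the root play symmetric roles; exchanging them makes the heavy one first.
    ... | no  _   | yes _  | no t≰  = subst (λ k → DistanceBound p q k d) (⊔-comm (height t) (height s))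
                                        (D′.bound-heavy-child d≤ (≰⇒> t≰))

  distance-≥ : ∀ {d} → p < q → q ≤ suc (suc p) → IsCenterCentroidDistance T d →
               p ≤ d + d + suc (height s ⊔ height t)
  distance-≥ p<q q≤ ((x , y , cx , cy , isD) , _) =
    subst (λ d → p ≤ d + d + suc (height s ⊔ height t)) (sym (Metric.dist-unique T conn isD))
      (D.distance-lower p<q q≤ cx cy)

-- Introduces `q`: since `N` is even, so is the number `A` of vertices of the rgood tree other than
-- its root, and `S` is `n / 2`.
inner-count : ∀ {A p N S} → suc A + suc (p + p) ≡ N → N ≡ S + S →
              ∃[ q ] S ≡ suc (p + q) × A ≡ q + q
inner-count {A} {p} {N} {S} N≡ even with m≤n⇒∃[o]m+o≡n {suc p} {S} (a+a≤1+b+b⇒a≤b (m≤n⇒m≤1+n (begin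
    suc p + suc p       ≡⟨ cong suc (+-suc p p) ⟩
    suc (suc (p + p))   ≤⟨ s≤s (m≤n+m (suc (p + p)) A) ⟩
    suc A + suc (p + p) ≡⟨ trans N≡ even ⟩
    S + S               ∎)))
  where open ≤-Reasoning
... | q , S≡ = q , sym S≡ , +-cancelʳ-≡ (suc (suc (p + p))) A (q + q) (begin
    A + suc (suc (p + p))         ≡⟨ +-suc A (suc (p + p)) ⟩
    suc A + suc (p + p)           ≡⟨ trans N≡ even ⟩
    S + S                         ≡⟨ cong₂ _+_ (sym S≡) (sym S≡) ⟩
    suc (p + q) + suc (p + q)     ≡⟨ rearrange p q ⟩
    q + q + suc (suc (p + p))     ∎)
  where
  open ≡-Reasoning
  rearrange : ∀ p q → suc (p + q) + suc (p + q) ≡ q + q + suc (suc (p + p))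
  rearrange p q = solve (p List.∷ q List.∷ List.[])

-- Twice the rounded-up quarter is `n / 2` or one more, which places `q*` at `p* + 1` or `p* + 2`.
quarter-bounds : ∀ {n S} → n ≡ S + S → S ≤ ⌈ n /4⌉ + ⌈ n /4⌉ × ⌈ n /4⌉ + ⌈ n /4⌉ ≤ suc S
quarter-bounds {n} {S} refl =
    a+a≤1+b+b⇒a≤b (m≤n⇒m≤1+n (lower S Q r (≤-pred (m%n<n (S + S + 3) 4)) division))
  , a+a≤1+b+b⇒a≤b (upper S Q r division)
  where
  Q = ⌈ S + S /4⌉
  r = (S + S + 3) % 4
  division : S + S + 3 ≡ r + Q * 4
  division = m≡m%n+[m/n]*n (S + S + 3) 4
  lower : ∀ S Q r → r ≤ 3 → S + S + 3 ≡ r + Q * 4 → S + S ≤ (Q + Q) + (Q + Q)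
  lower S Q r r≤ eq = linear 0 (+-mono-≤ r≤ (≤-reflexive eq)) (solve (S List.∷ Q List.∷ r List.∷ List.[]))
  upper : ∀ S Q r → S + S + 3 ≡ r + Q * 4 → (Q + Q) + (Q + Q) ≤ suc (suc S + suc S)
  upper S Q r eq = linear r (≤-reflexive (sym eq)) (solve (S List.∷ Q List.∷ r List.∷ List.[]))

record CrgData {n : ℕ} (l S : ℕ) (T : Graph n) : Set where
  field
    conn     : Connected T
    bridges  : AllBridges T
    {p q}    : ℕ
    {s t}    : Shape
    anatomy  : Anatomy T p s t
    balanced : Balanced (node s t)
    orders   : order s + order t ≡ q + q
    S≡       : S ≡ suc (p + q)
    l≡       : l ≡ suc (q + q)

crg-data : ∀ {n l S} {T : Graph n} → n ≡ S + S → 3 ≤ l → l < n → IsCrg n l T → CrgData l S T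
crg-data {n} {l} {S} n≡ 3≤l l<n crg with crg-anatomy 3≤l crg
... | conn , bridges , p , s , t , anatomy , l≡ , balanced , C≡
  with inner-count {order s + order t} {p} (begin
         order (node s t) + suc (p + p)   ≡⟨ cong₂ _+_ (sym l≡)
                                               (sym (suc-injective (trans (+-comm 1 (n ∸ l)) C≡))) ⟩
         l + (n ∸ l)                      ≡⟨ m+[n∸m]≡n (<⇒≤ l<n) ⟩
         n                                ∎) n≡
  where open ≡-Reasoning
...   | q , S≡ , orders = record
  { conn = conn ; bridges = bridges ; anatomy = anatomy ; balanced = balanced
  ; orders = orders ; S≡ = S≡ ; l≡ = trans l≡ (cong suc orders) }

theorem3p2 : ∀ (n : ℕ) → 12 ≤ n → 2 ∣ n →
    ∀ (m : ℕ) → ¬ (2 ∣ m) → 3 ≤ m → m < n →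
    ∀ (T : Graph n) → IsCrg n m T →
    ∀ (T* : Graph n) → IsCrg n (2 * ⌈ n /4⌉ + 1) T* →
    ∀ (d d* : ℕ) → IsCenterCentroidDistance T d → IsCenterCentroidDistance T* d* →
    d ≤ d*
theorem3p2 n 12≤n (divides S n≡S*2) m _ 3≤m m<n T crg T* crg* d d* isD isD* =
  distance-optimal
    (distance-bound D.conn D.bridges D.anatomy D.orders (trans n≡ (cong (λ S → S + S) D.S≡)) D.balanced isD)
    (proj₂ (balanced-range D.balanced D.orders))
    (suc-injective (trans (sym D.S≡) D*.S≡)) p*<q* q*≤
    (≤-pred (subst (6 ≤_) D.S≡ 6≤S))
    (proj₁ (balanced-range D*.balanced D*.orders))
    (distance-≥ D*.conn D*.bridges D*.anatomy D*.orders (trans n≡ (cong (λ S → S + S) D*.S≡)) D*.balanced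
      p*<q* q*≤ isD*)
  where
  n≡ : n ≡ S + S
  n≡ = trans n≡S*2 (trans (*-comm S 2) (cong (S +_) (+-identityʳ S)))
  6≤S : 6 ≤ S
  6≤S = a+a≤1+b+b⇒a≤b (m≤n⇒m≤1+n (subst (12 ≤_) n≡ 12≤n))
  Q = ⌈ n /4⌉
  S≤ = proj₁ (quarter-bounds {S = S} n≡)
  ≤S = proj₂ (quarter-bounds {S = S} n≡)
  l≡ : 2 * Q + 1 ≡ suc (Q + Q)
  l≡ = trans (+-comm (2 * Q) 1) (cong (λ k → suc (Q + k)) (+-identityʳ Q))
  l<n : 2 * Q + 1 < n
  l<n = subst₂ _<_ (sym l≡) (sym n≡) (begin-strict
    suc (Q + Q)   ≤⟨ s≤s ≤S ⟩
    2 + S         <⟨ +-monoˡ-< S (≤-trans (s≤s (s≤s (s≤s z≤n))) 6≤S) ⟩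
    S + S         ∎)
    where open ≤-Reasoning
  3≤l : 3 ≤ 2 * Q + 1
  3≤l = subst (3 ≤_) (sym l≡) (s≤s (≤-trans (s≤s (s≤s z≤n)) (≤-trans 6≤S S≤)))
  module D = CrgData (crg-data {S = S} n≡ 3≤m m<n crg)
  module D* = CrgData (crg-data {S = S} n≡ 3≤l l<n crg*)
  q*≡Q : D*.q ≡ Q
  q*≡Q = ≤-antisym
      (a+a≤1+b+b⇒a≤b (m≤n⇒m≤1+n (≤-reflexive same)))
      (a+a≤1+b+b⇒a≤b (m≤n⇒m≤1+n (≤-reflexive (sym same))))
    where
    same : D*.q + D*.q ≡ Q + Q
    same = suc-injective (trans (sym D*.l≡) l≡)
  -- Adding `q*` turns the claim into `S ≤ 2Q`, because `S = p* + q* + 1` and `q* = Q`; the next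
  -- bound comes from `2Q ≤ S + 1` in the same way.
  p*<q* : D*.p < D*.q
  p*<q* = +-cancelʳ-≤ D*.q (suc D*.p) D*.q (subst₂ _≤_ D*.S≡ (cong₂ _+_ (sym q*≡Q) (sym q*≡Q)) S≤)
  q*≤ : D*.q ≤ suc (suc D*.p)
  q*≤ = +-cancelʳ-≤ D*.q D*.q (suc (suc D*.p))
    (subst₂ _≤_ (cong₂ _+_ (sym q*≡Q) (sym q*≡Q)) (cong suc D*.S≡) ≤S)
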